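{- Let $T$ be a uniformly recurrent tree set over a finite alphabet $A$, with $A\subset T$. Then $T$ has a primitive $\mathcal{S}_e$-adic representation, where $\mathcal{S}_e$ is the set of elementary positive automorphisms on $A$. That is, there is a sequence $(\sigma_n)_{n\in\mathbb{N}}$ of elements of $\mathcal{S}_e$ (viewed as morphisms $A^*\to A^*$) which is primitive and satisfies $$T=\bigcap_{n\in\mathbb{N}}\mathrm{Fac}(\sigma_0\sigma_1\cdots\sigma_n(A^*)).$$
   Context: Words and sets. $A^*$ is the free monoid of finite words over the finite nonempty alphabet $A$. A set $T$ of words is factorial if it contains all factors of its elements. A factorial set $T$ is right-extendable if for every $w\in T$ there is a letter $a$ with $wa\in T$, and biextendable if for every $w\in T$ there are letters $a,b$ with $awb\in T$. A set $T$ is uniformly recurrent if it is (nonempty) factorial and right-extendable and for every $u\in T$ there is $n\ge 1$ such that $u$ is a factor of every word of $T$ of length $n$. Tree sets. For a factorial set $T$ and $w\in T$, let $L(w)=\{a\in A\mid aw\in T\}$, $R(w)=\{a\in A\mid wa\in T\}$, $E(w)=\{(a,b)\in A\times A\mid awb\in T\}$. The extension graph $G(w)$ is the undirected graph whose vertex set is the disjoint union of $L(w)$ and $R(w)$ and whose edges are the pairs $(a,b)\in E(w)$ (joining $a\in L(w)$ to $b\in R(w)$). $T$ is a tree set if it is factorial, biextendable, and for every $w\in T$ (including the empty word) the graph $G(w)$ is a tree, i.e. connected and acyclic. Elementary positive automorphisms. For $a,b\in A$ with $a\neq b$, let $\alpha_{a,b}$ be the automorphism of the free group on $A$ with $a\mapsto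 ab$ and $c\mapsto c$ for every letter $c\ne a$, and let $\tilde\alpha_{a,b}$ be the one with $a\mapsto ba$ and $c\mapsto c$ for every letter $c\neq a$. The elementary positive automorphisms on $A$ are all $\alpha_{a,b}$, $\tilde\alpha_{a,b}$ ($a\neq b$) together with the automorphisms induced by permutations of $A$; each restricts to a morphism $A^*\to A^*$. $S$-adic representations. For a set $W$ of words, $\mathrm{Fac}(W)$ is the set of factors of words of $W$. For a set $\mathcal{S}$ of morphisms, an $\mathcal{S}$-adic representation of a factorial set $T\subset A^*$ is a sequence $(\sigma_n)_{n\in\mathbb{N}}$ of elements of $\mathcal{S}$, $\sigma_n:A_{n+1}^*\to A_n^*$, $A_0=A$, such that $T=\bigcap_{n}\mathrm{Fac}(\sigma_0\cdots\sigma_n(A_{n+1}^*))$. The sequence is primitive if for every $r\ge 0$ there is $s>r$ such that every letter of $A_r$ occurs in every word $\sigma_r\cdots\sigma_{s-1}(a)$, $a\in A_s$. Here all $A_n=A$. -}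

module Defs where

open import Level using (Level; _⊔_) renaming (suc to lsuc)
open import Data.Nat using (ℕ; zero; suc; _∸_; _≤_; _<_)
open import Data.List using (List; []; _∷_; _++_; _∷ʳ_; [_]; length; concatMap)
open import Data.List.Membership.Propositional using (_∈_)
open import Data.List.Relation.Binary.Infix.Heterogeneous using (Infix)
open import Data.List.Relation.Unary.Linked using (Linked)
open import Data.List.Relation.Unary.Unique.Propositional using (Unique)
open import Data.Product using (∃-syntax; _×_)
open import Data.Sum using (_⊎_; inj₁; inj₂; [_,_]′)
open import Function using (id; _∘_)
open import Function.Bundles using (_↔_; Inverse)
open import Relation.Binary using (Rel)
open import Relation.Binary.Construct.Closure.ReflexiveTransitive using (Star)
open import Relation.Binary.Construct.Closure.Symmetric using (SymClosure)
open import Relation.Binary.PropositionalEquality using (_≡_; _≢_)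
open import Relation.Nullary using (¬_)
open import Relation.Unary using (Pred; _≐_; ⋂)

private
  variable
    a ℓ v p e : Level
    A : Set a

------------------------------------------------------------------------
-- Sets of words

infix 4 _isFactorOf_

_isFactorOf_ : {A : Set a} → List A → List A → Set a
_isFactorOf_ = Infix _≡_

Factorial : {A : Set a} → Pred (List A) ℓ → Set (a ⊔ ℓ)
Factorial T = ∀ u w → T w → u isFactorOf w → T u

RightExtendable : {A : Set a} → Pred (List A) ℓ → Set (a ⊔ ℓ)
RightExtendable T = ∀ w → T w → ∃[ x ] T (w ∷ʳ x)

Biextendable : {A : Set a} → Pred (List A) ℓ → Set (a ⊔ ℓ)
Biextendable T = ∀ w → T w → ∃[ x ] ∃[ y ] T (x ∷ w ∷ʳ y)

record UniformlyRecurrent {A : Set a} (T : Pred (List A) ℓ) : Set (a ⊔ ℓ) where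
  field
    nonempty        : ∃[ w ] T w
    factorial       : Factorial T
    rightExtendable : RightExtendable T
    recurrent       : ∀ u → T u →
                      ∃[ n ] (1 ≤ n × (∀ w → T w → length w ≡ n → u isFactorOf w))

------------------------------------------------------------------------
-- Undirected graphs

-- The vertices are the elements of V satisfying Vertex.  Joins lists every
-- edge in one arbitrary orientation; adjacency is its symmetric closure.
record Graph (V : Set v) p e : Set (v ⊔ lsuc (p ⊔ e)) where
  field
    Vertex : Pred V p
    Joins  : Rel V e

  Adjacent : Rel V e
  Adjacent = SymClosure Joins

  Connected : Set (v ⊔ p ⊔ e)
  Connected = ∀ x y → Vertex x → Vertex y → Star Adjacent x y

  -- A cycle is a closed walk x, xs, x through at least three vertices, all
  -- distinct except for the repetition of x at the end.
  Acyclic : Set (v ⊔ e)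
  Acyclic = ∀ x xs → 2 ≤ length xs → Unique (x ∷ xs) →
            ¬ Linked Adjacent (x ∷ xs ++ [ x ])

  IsTree : Set (v ⊔ p ⊔ e)
  IsTree = Connected × Acyclic

------------------------------------------------------------------------
-- Extension graphs and tree sets

module _ {A : Set a} (T : Pred (List A) ℓ) (w : List A) where

  L : Pred A ℓ
  L x = T (x ∷ w)

  R : Pred A ℓ
  R y = T (w ∷ʳ y)

  E : A → A → Set ℓ
  E x y = T (x ∷ w ∷ʳ y)

  -- The two copies of A keep L and R disjoint.  For factorial T, E x y
  -- implies L x and R y, so edges only join vertices.
  data ExtensionEdge : Rel (A ⊎ A) (a ⊔ ℓ) where
    edge : ∀ {x y} → E x y → ExtensionEdge (inj₁ x) (inj₂ y)

  extensionGraph : Graph (A ⊎ A) ℓ (a ⊔ ℓ)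
  extensionGraph = record { Vertex = [ L , R ]′ ; Joins = ExtensionEdge }

record TreeSet {A : Set a} (T : Pred (List A) ℓ) : Set (a ⊔ ℓ) where
  field
    factorial    : Factorial T
    biextendable : Biextendable T
    tree         : ∀ w → T w → Graph.IsTree (extensionGraph T w)

------------------------------------------------------------------------
-- Morphisms of free monoids

-- A morphism A* → A* is given by the images of the letters; extend σ is the
-- morphism itself.
Morphism : Set a → Set a
Morphism A = A → List A

extend : Morphism A → List A → List A
extend = concatMap

-- The restrictions to A* of the elementary positive automorphisms of the free
-- group on A.  These automorphisms are determined by the images of letters,
-- all of which are positive words.
data ElementaryPositive {A : Set a} (σ : Morphism A) : Set a where
  α    : ∀ x y → x ≢ y → σ x ≡ x ∷ y ∷ [] → (∀ z → z ≢ x → σ z ≡ [ z ]) →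
         ElementaryPositive σ
  α̃    : ∀ x y → x ≢ y → σ x ≡ y ∷ x ∷ [] → (∀ z → z ≢ x → σ z ≡ [ z ]) →
         ElementaryPositive σ
  perm : (π : A ↔ A) → (∀ z → σ z ≡ [ Inverse.to π z ]) →
         ElementaryPositive σ

------------------------------------------------------------------------
-- S-adic representations

-- compose σ r k = σ_r ∘ σ_{r+1} ∘ ⋯ ∘ σ_{r+k-1}
compose : (ℕ → Morphism A) → ℕ → ℕ → List A → List A
compose σ r zero    = id
compose σ r (suc k) = extend (σ r) ∘ compose σ (suc r) k

Image : {A : Set a} → (List A → List A) → Pred (List A) a
Image f w = ∃[ u ] f u ≡ w

Fac : {A : Set a} → Pred (List A) ℓ → Pred (List A) (a ⊔ ℓ)
Fac W u = ∃[ w ] (W w × u isFactorOf w)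

record SAdicRepresentation {A : Set a} (S : Pred (Morphism A) p)
                           (T : Pred (List A) ℓ) (σ : ℕ → Morphism A)
                           : Set (a ⊔ p ⊔ ℓ) where
  field
    elements     : ∀ n → S (σ n)
    intersection : T ≐ ⋂[ n ∶ ℕ ] Fac (Image (compose σ 0 (suc n)))

Primitive : {A : Set a} → (ℕ → Morphism A) → Set a
Primitive σ = ∀ r → ∃[ s ] (r < s × (∀ x y → y ∈ compose σ r (s ∸ r) [ x ]))

{-# OPTIONS --safe #-}

-- Let f enumerate the right return words to some w in T.  The return words to a longer word W ending with w
-- are products F j = f*(x j), and the main point is that the family x is, up to a bijection of its index set
-- with A, a product of elementary positive automorphisms.  Iterating this over longer and longer W gives the
-- representation; it is primitive because W can be chosen to contain every w f i.
--
-- As long as the family, initially x, is not bifix, write one of its words as X j = X i z or X j = z X i and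
-- replace it by z, which splits off an elementary automorphism.  Two facts, both obtained from the extension
-- trees, show that a bifix end point consists of the letters of A, each occurring once.  First, being a tree,
-- an extension graph turns any edge labelling into vertex potentials; applied to all words of a bounded length
-- this shows that the words F j, hence the words of the family, are independent in (ℤ/2)^A.  Second, whether
-- an occurrence of w in a long word is a cutting point of the decoding by a bifix family is determined by a
-- long enough context on either side; connectedness of the extension graphs removes the context letter by
-- letter, so every occurrence of w is a cutting point and the words of the family are single letters.

module Submission where

open import Level using (Level; Lift; _⊔_)
open import Data.Nat using (ℕ; zero; suc; _+_; _∸_; _≤_; _<_; z≤n; s≤s; _≤?_)
open import Data.Nat.Properties hiding (_≟_)
open import Data.Bool using (Bool; true; false; _xor_)
open import Data.Bool.Properties using (xor-assoc; xor-comm; xor-same; xor-identityʳ)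
import Data.Bool.Solver as BoolSolver
open import Data.Fin using (Fin; zero; suc)
import Data.Fin.Properties as Finₚ
open import Data.List using (List; []; _∷_; _++_; _∷ʳ_; [_]; length; concatMap; drop; map; filter; deduplicate; lookup; tabulate)
open import Data.List.Properties
open import Data.List.Reverse using (Reverse; reverseView; []; _∶_∶ʳ_)
open import Data.List.Membership.Propositional using (_∈_)
open import Data.List.Membership.Propositional.Properties
open import Data.List.Relation.Unary.Any using (here; there)
import Data.List.Relation.Unary.Any as Any
open import Data.List.Relation.Unary.Any.Properties using (lookup-index)
open import Data.List.Relation.Unary.All using (All; []; _∷_)
import Data.List.Relation.Unary.All as All
import Data.List.Relation.Unary.All.Properties as Allₚ
open import Data.List.Relation.Unary.AllPairs using ([]; _∷_)
open import Data.List.Relation.Unary.Linked using (Linked; []; [-]; _∷_)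
open import Data.List.Relation.Unary.Unique.Propositional using (Unique)
open import Data.List.Relation.Unary.Unique.DecPropositional.Properties using (deduplicate-!)
open import Data.List.Relation.Binary.Infix.Heterogeneous using (MkView; toView; fromView)
import Data.List.Relation.Binary.Pointwise as Pointwise
open import Data.Product using (∃-syntax; Σ-syntax; _×_; _,_; proj₁; proj₂)
open import Data.Sum using (_⊎_; inj₁; inj₂; [_,_]′)
import Data.Sum.Properties as Sumₚ
open import Data.Unit using (⊤)
open import Data.Empty using (⊥-elim)
open import Function using (id; _∘_; _⇔_; mk⇔; Equivalence)
open import Function.Bundles using (_↔_; Inverse)
open import Function.Properties.Inverse using (↔⇒↣; ↔-refl)
open import Relation.Binary using (DecidableEquality; Rel; IsEquivalence)
open import Relation.Binary.Construct.Closure.ReflexiveTransitive using (Star; ε; _◅_; _◅◅_)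
open import Relation.Binary.Construct.Closure.Symmetric using (fwd; bwd; symmetric)
open import Relation.Binary.PropositionalEquality using (_≡_; _≢_; refl; sym; trans; cong; cong₂; subst; module ≡-Reasoning)
open import Relation.Nullary using (¬_; Dec; yes; no; contradiction)
open import Relation.Nullary.Decidable using (map′; _×-dec_; ¬?; via-injection)
open import Relation.Unary using (Pred)
open import Tactic.MonoidSolver using (solve)
open import Defs

private
  variable
    a c ℓ p e : Level
    A B : Set a

-- Words

levi : ∀ (u : List A) {v} u' {v'} → u ++ v ≡ u' ++ v' →
       (∃[ x ] (u ≡ u' ++ x × v' ≡ x ++ v)) ⊎ (∃[ x ] (u' ≡ u ++ x × v ≡ x ++ v'))
levi []      u'       eq = inj₂ (u' , refl , eq)
levi (x ∷ u) []       eq = inj₁ (x ∷ u , refl , sym eq)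
levi (x ∷ u) (y ∷ u') eq with refl , eq′ ← ∷-injective eq with levi u u' eq′
... | inj₁ (z , refl , eq″) = inj₁ (z , refl , eq″)
... | inj₂ (z , refl , eq″) = inj₂ (z , refl , eq″)

split-at : ∀ n (u : List A) → n ≤ length u → ∃[ p ] ∃[ s ] (u ≡ p ++ s × length p ≡ n)
split-at zero    u       _         = [] , u , refl , refl
split-at (suc n) (x ∷ u) (s≤s n≤u) with p , s , refl , refl ← split-at n u n≤u =
  x ∷ p , s , refl , refl

split-at-end : ∀ n (u : List A) → n ≤ length u → ∃[ p ] ∃[ s ] (u ≡ p ++ s × length s ≡ n)
split-at-end n u n≤u with p , s , refl , eq ← split-at (length u ∸ n) u (m∸n≤m (length u) n) =
  p , s , refl , +-cancelˡ-≡ (length p) (length s) n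
    (trans (sym (length-++ p)) (sym (trans (cong (_+ n) eq) (m∸n+n≡m n≤u))))

snoc-view : ∀ (x : A) u → ∃[ v ] ∃[ y ] (x ∷ u ≡ v ∷ʳ y)
snoc-view x []      = [] , x , refl
snoc-view x (y ∷ u) with v , z , eq ← snoc-view y u = x ∷ v , z , cong (x ∷_) eq

prefix? : DecidableEquality A → ∀ (u v : List A) → Dec (∃[ z ] (v ≡ u ++ z))
prefix? _≟_ []      v       = yes (v , refl)
prefix? _≟_ (x ∷ u) []      = no λ ()
prefix? _≟_ (x ∷ u) (y ∷ v) = map′
  (λ { (refl , z , refl) → z , refl })
  (λ { (z , refl) → refl , z , refl })
  ((x ≟ y) ×-dec prefix? _≟_ u v)

Ends : List A → List A → Set _
Ends w s = ∃[ p ] (s ≡ p ++ w)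

ends? : DecidableEquality A → ∀ (w s : List A) → Dec (Ends w s)
ends? _≟_ w s with ≡-dec _≟_ s w
ends? _≟_ w s       | yes refl = yes ([] , refl)
ends? _≟_ w []      | no s≢w = no λ { ([] , eq) → s≢w eq }
ends? _≟_ w (x ∷ s) | no s≢w = map′
  (λ (p , eq) → x ∷ p , cong (x ∷_) eq)
  (λ { ([] , eq) → contradiction eq s≢w ; (y ∷ p , eq) → p , proj₂ (∷-injective eq) })
  (ends? _≟_ w s)

ends-++ : ∀ {w s : List A} q → Ends w s → Ends w (q ++ s)
ends-++ {w = w} q (p , refl) = q ++ p , sym (++-assoc q p w)

ends-trans : ∀ {u w s : List A} → Ends u w → Ends w s → Ends u s
ends-trans u⊑w (p , refl) = ends-++ p u⊑w

ends-drop : ∀ {w : List A} q s → length w ≤ length s → Ends w (q ++ s) → Ends w s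
ends-drop {w = w} q s w≤s (p , eq) with levi q p eq
... | inj₂ (x , _ , eq′) = x , eq′
... | inj₁ ([] , _ , eq′) = [] , sym eq′
... | inj₁ (y ∷ x , _ , refl) = ⊥-elim (<⇒≱ (s≤s (≤-trans (m≤n+m (length s) (length x))
                                  (≤-reflexive (sym (length-++ x))))) w≤s)

ends-common : ∀ {u v s : List A} → length u ≤ length v → Ends u s → Ends v s → Ends u v
ends-common {v = v} u≤v u⊑s (p , refl) = ends-drop p v u≤v u⊑s

≢[]⇒length>0 : ∀ {u : List A} → u ≢ [] → 0 < length u
≢[]⇒length>0 {u = []}    u≢[] = contradiction refl u≢[]
≢[]⇒length>0 {u = _ ∷ _} _    = s≤s z≤n

-- The linear functional on (ℤ/2)^A with coefficients `g`, applied to the abelianised word.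
par : (A → Bool) → List A → Bool
par g []      = false
par g (x ∷ u) = g x xor par g u

xor-cancel : ∀ x y → x xor (x xor y) ≡ y
xor-cancel x y = trans (sym (xor-assoc x x y)) (cong (_xor y) (xor-same x))

xor-cancelˡ : ∀ x {y z} → x xor y ≡ x xor z → y ≡ z
xor-cancelˡ x {y} {z} eq = trans (sym (xor-cancel x y)) (trans (cong (x xor_) eq) (xor-cancel x z))

par-++ : ∀ (g : A → Bool) u v → par g (u ++ v) ≡ par g u xor par g v
par-++ g []      v = refl
par-++ g (x ∷ u) v = trans (cong (g x xor_) (par-++ g u v)) (sym (xor-assoc (g x) _ _))

par-concatMap : ∀ (g : A → Bool) (f : B → List A) k → par g (concatMap f k) ≡ par (par g ∘ f) k
par-concatMap g f []      = refl
par-concatMap g f (i ∷ k) = trans (par-++ g (f i) _) (cong (par g (f i) xor_) (par-concatMap g f k))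

assoc₁ : ∀ (v z a w b : List A) → (v ++ z) ++ (a ++ w ++ b) ≡ v ++ (z ++ a ++ w) ++ b
assoc₁ {A = A} v z a w b = solve (++-monoid A)

assoc₂ : ∀ (s a w b : List A) → s ++ (a ++ w ++ b) ≡ (s ++ (a ++ w)) ++ b
assoc₂ {A = A} s a w b = solve (++-monoid A)

assoc₃ : ∀ (u p w r b : List A) → u ++ p ++ (w ++ r) ++ b ≡ ((u ++ p ++ w) ++ r) ++ b
assoc₃ {A = A} u p w r b = solve (++-monoid A)

assoc₄ : ∀ (p w r q s : List A) → (p ++ (w ++ r) ++ q) ++ s ≡ (p ++ w) ++ (r ++ q ++ s)
assoc₄ {A = A} p w r q s = solve (++-monoid A)

assoc₅ : ∀ (p w q u p′ q′ : List A) → ((p ++ w ++ q) ++ u) ++ (p′ ++ w ++ q′) ≡ p ++ (w ++ q ++ u ++ p′ ++ w) ++ q′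
assoc₅ {A = A} p w q u p′ q′ = solve (++-monoid A)

assoc₆ : ∀ (w q u p′ : List A) → (w ++ q ++ u ++ p′) ++ w ≡ w ++ q ++ u ++ p′ ++ w
assoc₆ {A = A} w q u p′ = solve (++-monoid A)

-- Free submonoids and codes

concatMap-∷ʳ : ∀ (f : B → List A) k i → concatMap f (k ∷ʳ i) ≡ concatMap f k ++ f i
concatMap-∷ʳ f k i = trans (concatMap-++ f k [ i ]) (cong (concatMap f k ++_) (++-identityʳ (f i)))

concatMap-concatMap : ∀ {C : Set c} (f : B → List A) (g : C → List B) k →
                      concatMap f (concatMap g k) ≡ concatMap (concatMap f ∘ g) k
concatMap-concatMap f g []      = refl
concatMap-concatMap f g (i ∷ k) =
  trans (concatMap-++ f (g i) (concatMap g k)) (cong (concatMap f (g i) ++_) (concatMap-concatMap f g k))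

++≢[] : ∀ {u : List A} {v} → u ≢ [] → [] ≢ u ++ v
++≢[] {u = []}    u≢[] eq = u≢[] refl
++≢[] {u = _ ∷ _} u≢[] ()

Nonempty : (B → List A) → Set _
Nonempty f = ∀ i → f i ≢ []

-- The case of empty `z` makes both conditions include injectivity of the family.
PrefixCode SuffixCode : (B → List A) → Set _
PrefixCode f = ∀ i j z → f j ≡ f i ++ z → i ≡ j
SuffixCode f = ∀ i j z → f j ≡ z ++ f i → i ≡ j

Generated : (B → List A) → List A → Set _
Generated f u = ∃[ k ] (u ≡ concatMap f k)

generated-++ : ∀ {f : B → List A} {u v} → Generated f u → Generated f v → Generated f (u ++ v)
generated-++ {f = f} (k , refl) (l , refl) = k ++ l , sym (concatMap-++ f k l)

generated-concatMap : ∀ {C : Set c} {f : B → List A} {g : C → List A} →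
                      (∀ i → Generated f (g i)) → ∀ k → Generated f (concatMap g k)
generated-concatMap h []      = [] , refl
generated-concatMap h (i ∷ k) = generated-++ (h i) (generated-concatMap h k)

module _ {f : B → List A} (nonempty : Nonempty f) where

  concatMap≡[] : ∀ k → concatMap f k ≡ [] → k ≡ []
  concatMap≡[] []      eq = refl
  concatMap≡[] (i ∷ k) eq = contradiction (sym eq) (++≢[] (nonempty i))

  module _ (code : PrefixCode f) where

    head-cancel : ∀ i j {u v} → f i ++ u ≡ f j ++ v → i ≡ j × u ≡ v
    head-cancel i j {u} {v} eq with code-head
      where
      code-head : i ≡ j
      code-head with levi (f i) (f j) eq
      ... | inj₁ (z , eq′ , _) = sym (code j i z eq′)
      ... | inj₂ (z , eq′ , _) = code i j z eq′
    ... | refl = refl , ++-cancelˡ (f i) u v eq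

    cancel-prefix : ∀ k k′ {q} → concatMap f k ++ q ≡ concatMap f k′ →
                    ∃[ k″ ] (k′ ≡ k ++ k″ × q ≡ concatMap f k″)
    cancel-prefix []      k′       eq = k′ , refl , eq
    cancel-prefix (i ∷ k) []       {q} eq =
      contradiction (trans (sym eq) (++-assoc (f i) _ q)) (++≢[] (nonempty i))
    cancel-prefix (i ∷ k) (j ∷ k′) {q} eq
      with refl , eq′ ← head-cancel i j (trans (sym (++-assoc (f i) _ q)) eq)
      with k″ , refl , eq″ ← cancel-prefix k k′ eq′ = k″ , refl , eq″

    concatMap-injective : ∀ k k′ → concatMap f k ≡ concatMap f k′ → k ≡ k′
    concatMap-injective k k′ eq
      with k″ , refl , eq′ ← cancel-prefix k k′ (trans (++-identityʳ _) eq)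
      with refl ← concatMap≡[] k″ (sym eq′) = sym (++-identityʳ k)

    generated-cancelˡ : ∀ {u v} → Generated f u → Generated f (u ++ v) → Generated f v
    generated-cancelˡ (k , refl) (k′ , eq) with k″ , _ , eq′ ← cancel-prefix k k′ eq = k″ , eq′

  module _ (code : SuffixCode f) where

    cancel-suffix : ∀ {k k′ q} → Reverse k → Reverse k′ → q ++ concatMap f k ≡ concatMap f k′ → Generated f q
    cancel-suffix {k′ = k′} [] _ eq = k′ , trans (sym (++-identityʳ _)) eq
    cancel-suffix {q = q} (k ∶ rk ∶ʳ i) [] eq =
      contradiction (sym (++-conicalʳ (concatMap f k) (f i) (trans (sym (concatMap-∷ʳ f k i))
        (++-conicalʳ q _ eq)))) (λ eq → nonempty i (sym eq))
    cancel-suffix {q = q} (k ∶ rk ∶ʳ i) (k′ ∶ rk′ ∶ʳ j) eq = rest (code-last (levi (q ++ concatMap f k) (concatMap f k′) eq′))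
      where
      eq′ : (q ++ concatMap f k) ++ f i ≡ concatMap f k′ ++ f j
      eq′ = trans (++-assoc q _ (f i)) (trans (cong (q ++_) (sym (concatMap-∷ʳ f k i)))
              (trans eq (concatMap-∷ʳ f k′ j)))
      code-last : (∃[ x ] (q ++ concatMap f k ≡ concatMap f k′ ++ x × f j ≡ x ++ f i)) ⊎
                  (∃[ x ] (concatMap f k′ ≡ (q ++ concatMap f k) ++ x × f i ≡ x ++ f j)) → i ≡ j
      code-last (inj₁ (x , _ , e)) = code i j x e
      code-last (inj₂ (x , _ , e)) = sym (code j i x e)
      rest : i ≡ j → Generated f q
      rest refl = cancel-suffix rk rk′ (++-cancelʳ (f i) _ _ eq′)

    generated-cancelʳ : ∀ {u v} → Generated f v → Generated f (u ++ v) → Generated f u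
    generated-cancelʳ (k , refl) (k′ , eq) = cancel-suffix (reverseView k) (reverseView k′) eq

update : DecidableEquality B → (B → A) → B → A → B → A
update _≟_ f j z k with k ≟ j
... | yes _ = z
... | no _  = f k

update-same : ∀ (_≟_ : DecidableEquality B) (f : B → A) j z → update _≟_ f j z j ≡ z
update-same _≟_ f j z with j ≟ j
... | yes _  = refl
... | no j≢j = contradiction refl j≢j

update-other : ∀ (_≟_ : DecidableEquality B) (f : B → A) j z k → k ≢ j → update _≟_ f j z k ≡ f k
update-other _≟_ f j z k k≢j with k ≟ j
... | yes k≡j = contradiction k≡j k≢j
... | no _    = refl

total : ∀ {m} → (Fin m → ℕ) → ℕ
total {zero}  f = 0
total {suc m} f = f zero + total (f ∘ suc)

total-mono : ∀ {m} {f g : Fin m → ℕ} → (∀ j → f j ≤ g j) → total f ≤ total g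
total-mono {zero}  h = z≤n
total-mono {suc m} h = +-mono-≤ (h zero) (total-mono (h ∘ suc))

total-mono-< : ∀ {m} {f g : Fin m → ℕ} → (∀ j → f j ≤ g j) → ∀ j → f j < g j → total f < total g
total-mono-< h zero    lt = +-mono-<-≤ lt (total-mono (h ∘ suc))
total-mono-< h (suc j) lt = +-mono-≤-< (h zero) (total-mono-< (h ∘ suc) j lt)

-- Products of elementary positive automorphisms

Elementary : Set a → Set a
Elementary A = ∃[ σ ] ElementaryPositive {A = A} σ

eval : List (Elementary A) → List A → List A
eval []       u = u
eval (σ ∷ σs) u = extend (proj₁ σ) (eval σs u)

eval-∷ʳ : ∀ (σs : List (Elementary A)) σ u → eval (σs ∷ʳ σ) u ≡ eval σs (extend (proj₁ σ) u)
eval-∷ʳ []       σ u = refl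
eval-∷ʳ (τ ∷ σs) σ u = cong (extend (proj₁ τ)) (eval-∷ʳ σs σ u)

eval-++ : ∀ (σs : List (Elementary A)) u v → eval σs (u ++ v) ≡ eval σs u ++ eval σs v
eval-++ []       u v = refl
eval-++ (σ ∷ σs) u v = trans (cong (extend (proj₁ σ)) (eval-++ σs u v)) (concatMap-++ (proj₁ σ) (eval σs u) (eval σs v))

eval-concatMap : ∀ (σs : List (Elementary A)) u → eval σs u ≡ concatMap (λ x → eval σs [ x ]) u
eval-concatMap []       u = sym (concatMap-pure u)
eval-concatMap (σ ∷ σs) u = trans (cong (extend (proj₁ σ)) (eval-concatMap σs u))
  (concatMap-concatMap (proj₁ σ) (λ x → eval σs [ x ]) u)

-- Graphs

module _ {v} {V : Set v} (G : Graph V p e) (_≟_ : DecidableEquality V)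
         (irreflexive : ∀ x → ¬ Graph.Adjacent G x x) (acyclic : Graph.Acyclic G)
         (weight : V → V → Bool) (weight-sym : ∀ x y → weight x y ≡ weight y x) where

  open Graph G
  open import Data.List.Membership.DecPropositional _≟_ using (_∈?_)

  data Path : V → List V → V → Set (v ⊔ e) where
    nil  : ∀ {x} → Path x [] x
    cons : ∀ {x y ys z} → Adjacent x y → Path y ys z → Path x (y ∷ ys) z

  pathWeight : V → List V → Bool
  pathWeight x []       = false
  pathWeight x (y ∷ ys) = weight x y xor pathWeight y ys

  starWeight : ∀ {x y} → Star Adjacent x y → Bool
  starWeight ε                       = false
  starWeight {x} (_◅_ {j = y} x~y s) = weight x y xor starWeight s

  starWeight-◅◅ : ∀ {x y z} (s : Star Adjacent x y) (t : Star Adjacent y z) →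
                  starWeight (s ◅◅ t) ≡ starWeight s xor starWeight t
  starWeight-◅◅ ε         t = refl
  starWeight-◅◅ {x} (_◅_ {j = y} x~y s) t =
    trans (cong (weight x y xor_) (starWeight-◅◅ s t)) (sym (xor-assoc (weight x y) _ _))

  path-split : ∀ {x ys z v} → Path x ys z → v ∈ x ∷ ys →
               ∃[ as ] ∃[ bs ] (ys ≡ as ++ bs × Path x as v × Path v bs z ×
                                pathWeight x ys ≡ pathWeight x as xor pathWeight v bs)
  path-split {ys = ys} P (here refl) = [] , ys , refl , nil , P , refl
  path-split {x} (cons {y = y} x~y P) (there v∈) with path-split P v∈
  ... | as , bs , refl , P₁ , P₂ , eq = y ∷ as , bs , refl , cons x~y P₁ , P₂ ,
        trans (cong (weight x y xor_) eq) (sym (xor-assoc (weight x y) _ _))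

  path-linked : ∀ {x as z v} → Path x as z → Adjacent z v → Linked Adjacent (x ∷ as ++ [ v ])
  path-linked nil                    z~v = z~v ∷ [-]
  path-linked (cons x~y nil)         z~v = x~y ∷ path-linked nil z~v
  path-linked (cons x~y (cons q P))  z~v = x~y ∷ path-linked (cons q P) z~v

  -- A path without edges would close to a loop, and one with at least two edges to a cycle; only a
  -- single edge remains.
  closed-path : ∀ {x as z} → Path x as z → Unique (x ∷ as) → Adjacent z x → as ≡ [ z ]
  closed-path nil                   _ z~x = contradiction z~x (irreflexive _)
  closed-path (cons _ nil)          _ z~x = refl
  closed-path (cons p (cons q P)) uniq z~x =
    contradiction (path-linked (cons p (cons q P)) z~x) (acyclic _ _ (s≤s (s≤s z≤n)) uniq)

  Unique-++ʳ : ∀ (as : List V) {bs} → Unique (as ++ bs) → Unique bs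
  Unique-++ʳ []       u       = u
  Unique-++ʳ (x ∷ as) (_ ∷ u) = Unique-++ʳ as u

  Unique-++ˡ : ∀ (as : List V) {bs} → Unique (as ++ bs) → Unique as
  Unique-++ˡ []       u       = []
  Unique-++ˡ (x ∷ as) (p ∷ u) = Allₚ.++⁻ˡ as p ∷ Unique-++ˡ as u

  path-last : ∀ {x as z} → Path x as z → ∃[ ps ] (x ∷ as ≡ ps ∷ʳ z)
  path-last nil        = [] , refl
  path-last {x} (cons _ P) with ps , eq ← path-last P = x ∷ ps , cong (x ∷_) eq

  Unique-join : ∀ {x as bs z} → Path x as z → Unique (x ∷ as ++ bs) → Unique (z ∷ bs)
  Unique-join {as = as} {bs} {z} P u with ps , eq ← path-last P =
    Unique-++ʳ ps (subst Unique (trans (cong (_++ bs) eq) (++-assoc ps [ z ] bs)) u)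

  -- Loop erasure; an erased loop runs along one edge and back, since there are no cycles.
  simplify : ∀ {x y} (s : Star Adjacent x y) →
             ∃[ ys ] (Path x ys y × Unique (x ∷ ys) × pathWeight x ys ≡ starWeight s)
  simplify ε = [] , nil , [] ∷ [] , refl
  simplify {x} (_◅_ {j = y} x~y s) with simplify s
  ... | ys , P , uniq , eq with x ∈? (y ∷ ys)
  ...   | no x∉ = y ∷ ys , cons x~y P , All.tabulate (λ {v} v∈ x≡v → x∉ (subst (λ u → u ∈ y ∷ ys) (sym x≡v) v∈)) ∷ uniq ,
                  cong (weight x y xor_) eq
  ...   | yes x∈ with path-split P x∈
  ...     | as , bs , refl , P₁ , P₂ , eq′
            with refl ← closed-path P₁ (Unique-++ˡ (y ∷ as) uniq) x~y =
              bs , P₂ , Unique-join P₁ uniq ,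
              (begin
                pathWeight x bs
                  ≡⟨ xor-cancel (weight x y) _ ⟨
                weight x y xor (weight x y xor pathWeight x bs)
                  ≡⟨ cong (weight x y xor_) (cong (_xor pathWeight x bs) (trans (weight-sym x y) (sym (xor-identityʳ (weight y x))))) ⟩
                weight x y xor ((weight y x xor false) xor pathWeight x bs)
                  ≡⟨ cong (weight x y xor_) eq′ ⟨
                weight x y xor pathWeight y (x ∷ bs)
                  ≡⟨ cong (weight x y xor_) eq ⟩
                weight x y xor starWeight s ∎)
    where open ≡-Reasoning

  -- Loop erasure keeps the weight modulo 2, and in a forest the only simple path between adjacent
  -- vertices is the edge itself.
  edge-weight : ∀ {x y} (s : Star Adjacent x y) → Adjacent x y → starWeight s ≡ weight x y
  edge-weight {x} {y} s x~y with ys , P , uniq , eq ← simplify s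
    with refl ← closed-path P uniq (symmetric Joins x~y) = trans (sym eq) (xor-identityʳ (weight x y))

  -- The length of the loop-erased walk decides: an edge between the ends would close any longer
  -- path to a cycle.
  adjacent? : ∀ {x y} → x ≢ y → Star Adjacent x y → Dec (Adjacent x y)
  adjacent? {x} {y} x≢y s with simplify s
  ... | .[] , nil , uniq , _ = contradiction refl x≢y
  ... | .(_ ∷ []) , cons x~y nil , uniq , _ = yes x~y
  ... | .(_ ∷ _ ∷ _) , P@(cons p (cons q R)) , uniq , _ =
        no λ x~y → contradiction (cong length (closed-path P uniq (symmetric Joins x~y))) λ ()

-- Words of a tree set and their extension graphs

module TreeSetTheory {a ℓ : Level} {A : Set a} {n : ℕ} (ι : A ↔ Fin (suc n)) (T : Pred (List A) ℓ)
  (ur : UniformlyRecurrent T) (ts : TreeSet T) (letter : ∀ x → T [ x ]) where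

  open UniformlyRecurrent ur using (recurrent)
  open TreeSet ts

  _≟_ : DecidableEquality A
  _≟_ = via-injection (↔⇒↣ ι) Finₚ._≟_

  factor⁻ : ∀ {u w : List A} → u isFactorOf w → ∃[ p ] ∃[ q ] (w ≡ p ++ u ++ q)
  factor⁻ f with MkView p u≋ q ← toView f with refl ← Pointwise.Pointwise-≡⇒≡ u≋ = p , q , refl

  factor⁺ : ∀ p (u : List A) q → u isFactorOf (p ++ u ++ q)
  factor⁺ p u q = fromView (MkView p (Pointwise.≡⇒Pointwise-≡ {x = u} refl) q)

  T-factor : ∀ p u q → T (p ++ u ++ q) → T u
  T-factor p u q t = factorial u _ t (factor⁺ p u q)

  T-suffix : ∀ p u → T (p ++ u) → T u
  T-suffix p u t = T-factor p u [] (subst (λ v → T (p ++ v)) (sym (++-identityʳ u)) t)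

  T-prefix : ∀ u q → T (u ++ q) → T u
  T-prefix u q = T-factor [] u q

  T-[] : T []
  T-[] = T-prefix [] _ (proj₂ (UniformlyRecurrent.nonempty ur))

  extendˡ : ∀ k u → T u → ∃[ v ] (length v ≡ k × T (v ++ u))
  extendˡ zero    u t = [] , refl , t
  extendˡ (suc k) u t with v , eq , t′ ← extendˡ k u t with x , y , t″ ← biextendable (v ++ u) t′ =
    x ∷ v , cong suc eq , T-prefix (x ∷ v ++ u) [ y ] t″

  extendʳ : ∀ k u → T u → ∃[ v ] (length v ≡ k × T (u ++ v))
  extendʳ zero    u t = [] , refl , subst T (sym (++-identityʳ u)) t
  extendʳ (suc k) u t with x , y , t′ ← biextendable u t
    with v , eq , t″ ← extendʳ k (u ∷ʳ y) (T-suffix [ x ] (u ∷ʳ y) t′) =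
    y ∷ v , cong suc eq , subst T (++-assoc u [ y ] v) t″

  occurs : ∀ u → T u → ∃[ N ] (∀ s → T s → N ≤ length s → ∃[ p ] ∃[ q ] (s ≡ p ++ u ++ q))
  occurs u t with N , _ , h ← recurrent u t = N , λ s ts N≤s → found s ts (split-at N s N≤s)
    where
    found : ∀ s → T s → ∃[ p ] ∃[ r ] (s ≡ p ++ r × length p ≡ N) → ∃[ p ] ∃[ q ] (s ≡ p ++ u ++ q)
    found s ts (s₁ , s₂ , refl , len) with p , q , refl ← factor⁻ (h s₁ (T-prefix s₁ s₂ ts) len) =
      p , q ++ s₂ , trans (++-assoc p (u ++ q) s₂) (cong (p ++_) (++-assoc u q s₂))

  module ExtensionGraph (w : List A) (tw : T w) where
    G = extensionGraph T w
    open Graph G public using (Adjacent)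

    _≟ᵛ_ : DecidableEquality (A ⊎ A)
    _≟ᵛ_ = Sumₚ.≡-dec _≟_ _≟_

    irreflexive : ∀ x → ¬ Adjacent x x
    irreflexive (inj₁ _) (fwd ())
    irreflexive (inj₁ _) (bwd ())
    irreflexive (inj₂ _) (fwd ())
    irreflexive (inj₂ _) (bwd ())

    connect : Graph.Connected G
    connect = proj₁ (tree w tw)

    acyclic : Graph.Acyclic G
    acyclic = proj₂ (tree w tw)

    module Weighted (h : A → A → Bool) where
      weight : A ⊎ A → A ⊎ A → Bool
      weight (inj₁ x) (inj₂ y) = h x y
      weight (inj₂ y) (inj₁ x) = h x y
      weight _        _        = false

      weight-sym : ∀ x y → weight x y ≡ weight y x
      weight-sym (inj₁ _) (inj₁ _) = refl
      weight-sym (inj₁ _) (inj₂ _) = refl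
      weight-sym (inj₂ _) (inj₁ _) = refl
      weight-sym (inj₂ _) (inj₂ _) = refl

      sw : ∀ {x y} → Star Adjacent x y → Bool
      sw = starWeight G _≟ᵛ_ irreflexive acyclic weight weight-sym

      sw-◅◅ : ∀ {x y z} (s : Star Adjacent x y) (t : Star Adjacent y z) → sw (s ◅◅ t) ≡ sw s xor sw t
      sw-◅◅ = starWeight-◅◅ G _≟ᵛ_ irreflexive acyclic weight weight-sym

      sw-edge : ∀ {x y} (s : Star Adjacent x y) → Adjacent x y → sw s ≡ weight x y
      sw-edge = edge-weight G _≟ᵛ_ irreflexive acyclic weight weight-sym

    extension? : ∀ x y → T (x ∷ w) → T (w ∷ʳ y) → Dec (T (x ∷ w ∷ʳ y))
    extension? x y tx ty = map′ (λ { (fwd (edge t)) → t }) (fwd ∘ edge)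
      (adjacent? G _≟ᵛ_ irreflexive acyclic (λ _ _ → false) (λ _ _ → refl)
        {inj₁ x} {inj₂ y} (λ ()) (connect (inj₁ x) (inj₂ y) tx ty))

  -- Decidability of `T` comes from the trees: for a word `x v z` decide `x v` and `v z` first, then
  -- whether `x` and `z` are adjacent in the extension graph of `v`. The bound `k` makes the
  -- recursion structural.
  T?-bounded : ∀ k u → length u ≤ k → Dec (T u)
  T?-bounded k       []      _ = yes T-[]
  T?-bounded (suc k) (x ∷ u) (s≤s len) with T?-bounded k u len
  ... | no ¬tu = no (¬tu ∘ T-suffix [ x ] u)
  T?-bounded (suc k) (x ∷ [])    _         | yes _ = yes (letter x)
  T?-bounded (suc k) (x ∷ y ∷ u) (s≤s len) | yes tu with v , z , eq ← snoc-view y u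
    with T?-bounded k (x ∷ v) (subst (_≤ k) (trans (cong length eq) (trans (length-++ v) (+-comm (length v) 1))) len)
  ...   | no ¬tv = no λ t → ¬tv (T-prefix (x ∷ v) [ z ] (subst (λ s → T (x ∷ s)) eq t))
  ...   | yes tv = map′ (subst (λ s → T (x ∷ s)) (sym eq)) (subst (λ s → T (x ∷ s)) eq)
                     (ExtensionGraph.extension? v (T-suffix [ x ] v tv) x z tv (subst T eq tu))

  T? : ∀ u → Dec (T u)
  T? u = T?-bounded (length u) u ≤-refl

  -- In a tree, every edge labelling splits into vertex potentials: take the weights of walks to a root.
  potentials : ∀ w → T w → (h : A → A → Bool) →
               Σ[ lam ∈ (A → Bool) ] Σ[ rho ∈ (A → Bool) ] (∀ x y → T (x ∷ w ∷ʳ y) → h x y ≡ lam x xor rho y)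
  potentials w tw h = lam , rho , split
    where
    open ExtensionGraph w tw
    open Weighted h
    root = proj₁ (proj₂ (biextendable w tw))

    t-root : T (w ∷ʳ root)
    t-root = T-suffix [ _ ] (w ∷ʳ root) (proj₂ (proj₂ (biextendable w tw)))

    lam rho : A → Bool
    lam x with T? (x ∷ w)
    ... | yes tx = sw (connect (inj₁ x) (inj₂ root) tx t-root)
    ... | no _   = false
    rho y with T? (w ∷ʳ y)
    ... | yes ty = sw (connect (inj₂ root) (inj₂ y) t-root ty)
    ... | no _   = false

    to-root : ∀ x → T (x ∷ w) → ∃[ s ] (sw {inj₁ x} {inj₂ root} s ≡ lam x)
    to-root x tx with T? (x ∷ w)
    ... | yes tx′ = connect (inj₁ x) (inj₂ root) tx′ t-root , refl
    ... | no ¬tx = contradiction tx ¬tx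

    from-root : ∀ y → T (w ∷ʳ y) → ∃[ s ] (sw {inj₂ root} {inj₂ y} s ≡ rho y)
    from-root y ty with T? (w ∷ʳ y)
    ... | yes ty′ = connect (inj₂ root) (inj₂ y) t-root ty′ , refl
    ... | no ¬ty = contradiction ty ¬ty

    split : ∀ x y → T (x ∷ w ∷ʳ y) → h x y ≡ lam x xor rho y
    split x y t with s , eq ← to-root x (T-prefix (x ∷ w) [ y ] t)
                   | s′ , eq′ ← from-root y (T-suffix [ x ] (w ∷ʳ y) t) =
      -- The walk through the root has the same ends as the edge, so its weight is the label of the
      -- edge.
      trans (sym (sw-edge (s ◅◅ s′) (fwd (edge t)))) (trans (sw-◅◅ s s′) (cong₂ _xor_ eq eq′))

  -- Connectivity of the extension graph of z₁ z₂ lets one drop a letter of context on either side of the pair.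
  module Descent {p s} (P : Pred (List A) p) (P-∷ : ∀ x z → P z → P (x ∷ z))
                 {_∼_ : Rel (List A) s} (equiv : IsEquivalence _∼_) (M N : ℕ) (M≤N : M ≤ N) where

    -- `z₁` and `z₂` are the context left and right of a position; the whole left part, once it is
    -- long, has a class that depends on this context only.
    Determined : List A → List A → Set (a ⊔ ℓ ⊔ s)
    Determined z₁ z₂ = ∀ v v′ → N ≤ length (v ++ z₁) → N ≤ length (v′ ++ z₁) →
                       T ((v ++ z₁) ++ z₂) → T ((v′ ++ z₁) ++ z₂) → (v ++ z₁) ∼ (v′ ++ z₁)

    module _ {z₁ z₂} (short : length (z₁ ++ z₂) < M)
             (left : ∀ x → Determined (x ∷ z₁) z₂) (right : ∀ y → Determined z₁ (z₂ ∷ʳ y)) where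
      open IsEquivalence equiv using () renaming (trans to ∼-trans)

      -- By `left` and `right` each vertex of the extension graph of `z₁ z₂` owns a single class. A
      -- word `x z₁ z₂ y`, extended far to the left, provides a left part common to both ends of an
      -- edge, so the class is constant along walks.
      At : A ⊎ A → List A → Set (a ⊔ ℓ)
      At (inj₁ x) s = ∃[ v ] (s ≡ v ++ x ∷ z₁ × N ≤ length s × T (s ++ z₂))
      At (inj₂ y) s = ∃[ v ] (s ≡ v ++ z₁ × N ≤ length s × T (s ++ z₂ ∷ʳ y))

      at-same : ∀ x {s s′} → At x s → At x s′ → s ∼ s′
      at-same (inj₁ x) (v , refl , len , t) (v′ , refl , len′ , t′) = left x v v′ len len′ t t′
      at-same (inj₂ y) (v , refl , len , t) (v′ , refl , len′ , t′) = right y v v′ len len′ t t′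

      at-edge : ∀ {x y} → T (x ∷ (z₁ ++ z₂) ∷ʳ y) → ∃[ s ] (At (inj₁ x) s × At (inj₂ y) s)
      at-edge {x} {y} t with v , refl , t′ ← extendˡ N _ t =
        v ++ x ∷ z₁ ,
        (v , refl , long , T-prefix _ [ y ] (subst T eq t′)) ,
        (v ∷ʳ x , sym (++-assoc v [ x ] z₁) , long , subst T (trans eq (++-assoc (v ++ x ∷ z₁) z₂ [ y ])) t′)
        where
        long : N ≤ length (v ++ x ∷ z₁)
        long = subst (N ≤_) (sym (length-++ v)) (m≤m+n N _)
        eq : v ++ x ∷ (z₁ ++ z₂) ∷ʳ y ≡ ((v ++ x ∷ z₁) ++ z₂) ++ [ y ]
        eq = trans (sym (++-assoc v (x ∷ z₁ ++ z₂) [ y ])) (cong (_++ [ y ]) (sym (++-assoc v (x ∷ z₁) z₂)))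

      at-walk : ∀ {tz x y} → Star (ExtensionGraph.Adjacent (z₁ ++ z₂) tz) x y →
                ∀ {s s′} → At x s → At y s′ → s ∼ s′
      at-walk {x = x} ε h h′ = at-same x h h′
      at-walk {tz} {x} (fwd (edge t) ◅ w) h h′ with s , hx , hy ← at-edge t =
        ∼-trans (at-same x h hx) (at-walk {tz} w hy h′)
      at-walk {tz} {x} (bwd (edge t) ◅ w) h h′ with s , hx , hy ← at-edge t =
        ∼-trans (at-same x h hy) (at-walk {tz} w hx h′)

      last-letter : ∀ v → N ≤ length (v ++ z₁) → T ((v ++ z₁) ++ z₂) →
                    ∃[ x ] (At (inj₁ x) (v ++ z₁) × T (x ∷ z₁ ++ z₂))
      -- With `v` empty, `z₁` would have length at least `N`, although `z₁ z₂` is shorter than `M`.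
      last-letter []      len t = contradiction (≤-trans M≤N (≤-trans len
        (subst (length z₁ ≤_) (sym (length-++ z₁)) (m≤m+n (length z₁) (length z₂))))) (<⇒≱ short)
      last-letter (y ∷ v) len t with v′ , x , eq ← snoc-view y v =
        x , (v′ , eq′ , len , t) ,
        T-suffix v′ _ (subst T (trans (cong (_++ z₂) eq′) (++-assoc v′ (x ∷ z₁) z₂)) t)
        where
        eq′ = trans (cong (_++ z₁) eq) (++-assoc v′ [ x ] z₁)

      step : Determined z₁ z₂
      step v v′ len len′ t t′ with x , h , tx ← last-letter v len t | x′ , h′ , tx′ ← last-letter v′ len′ t′ =
        at-walk {tz} (ExtensionGraph.connect (z₁ ++ z₂) tz (inj₁ x) (inj₁ x′) tx tx′) h h′
        where tz = T-suffix [ x ] (z₁ ++ z₂) tx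

    module _ (base : ∀ z₁ z₂ → P z₁ → M ≤ length (z₁ ++ z₂) → Determined z₁ z₂) where

      -- Induction on a bound `d` for the number of letters that the context lacks to reach length
      -- `M`, where `base` takes over.
      determined-within : ∀ d z₁ z₂ → P z₁ → M ≤ d + length (z₁ ++ z₂) → Determined z₁ z₂
      determined-within zero    z₁ z₂ pz M≤ = base z₁ z₂ pz M≤
      determined-within (suc d) z₁ z₂ pz M≤ with M ≤? length (z₁ ++ z₂)
      ... | yes M≤′ = base z₁ z₂ pz M≤′
      ... | no M≰ = step (≰⇒> M≰)
        (λ x → determined-within d (x ∷ z₁) z₂ (P-∷ x z₁ pz) (subst (M ≤_) (sym (+-suc d _)) M≤))
        (λ y → determined-within d z₁ (z₂ ∷ʳ y) pz
          (subst (M ≤_) (trans (sym (+-suc d _)) (cong (d +_) (sym (length-snoc y)))) M≤))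
        where
        length-snoc : ∀ y → length (z₁ ++ z₂ ∷ʳ y) ≡ suc (length (z₁ ++ z₂))
        length-snoc y = trans (cong length (sym (++-assoc z₁ z₂ [ y ])))
                              (trans (length-++ (z₁ ++ z₂)) (+-comm _ 1))

      determined : ∀ z₁ z₂ → P z₁ → Determined z₁ z₂
      determined z₁ z₂ pz = determined-within M z₁ z₂ pz (m≤m+n M _)

  -- Labellings of words up to coboundaries

  split-labels : (h : A → List A → A → Bool) →
                 Σ[ lam ∈ (A → List A → Bool) ] Σ[ rho ∈ (List A → A → Bool) ]
                   (∀ x u y → T (x ∷ u ∷ʳ y) → h x u y ≡ lam x u xor rho u y)
  split-labels h = lam , rho , split
    where
    lam : A → List A → Bool
    lam x u with T? u
    ... | yes tu = proj₁ (potentials u tu (λ x y → h x u y)) x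
    ... | no _   = false

    rho : List A → A → Bool
    rho u y with T? u
    ... | yes tu = proj₁ (proj₂ (potentials u tu (λ x y → h x u y))) y
    ... | no _   = false

    split : ∀ x u y → T (x ∷ u ∷ʳ y) → h x u y ≡ lam x u xor rho u y
    split x u y t with T? u
    ... | yes tu = proj₂ (proj₂ (potentials u tu (λ x y → h x u y))) x y t
    ... | no ¬tu = contradiction (T-factor [ x ] u [ y ] t) ¬tu

  uncons : (A → List A → Bool) → List A → Bool
  uncons f []      = false
  uncons f (x ∷ u) = f x u

  -- Splitting the labels at the words of length k, then k - 1, ..., 0 leaves a function of the last letter
  -- up to a coboundary.
  letter-cohomologous : ∀ k (h : A → List A → A → Bool) →
    Σ[ g ∈ (A → Bool) ] Σ[ K ∈ (List A → Bool) ]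
      (∀ x u y → length u ≡ k → T (x ∷ u ∷ʳ y) → h x u y ≡ g y xor (K (x ∷ u) xor K (u ∷ʳ y)))
  letter-cohomologous zero h with lam , rho , split ← split-labels h =
    (λ y → rho [] y xor lam y []) ,
    uncons lam ,
    λ { x [] y refl t → trans (split x [] y t)
          (solve′ 3 (λ l r m → l :+ r := (r :+ m) :+ (l :+ m)) refl (lam x []) (rho [] y) (lam y [])) }
    where open BoolSolver.xor-∧-Solver renaming (solve to solve′)
  letter-cohomologous (suc k) h with lam , rho , split ← split-labels h
    -- Adding the coboundary of `lam` to the label leaves the sum of `rho u y` and `lam` at `u y`.
    -- This no longer involves `x`, so it is a label at a middle word one letter shorter.
    with g , K′ , eq ← letter-cohomologous k (λ x u y → rho (x ∷ u) y xor uncons lam (x ∷ u ∷ʳ y)) =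
    g , (λ s → uncons lam s xor K′ (drop 1 s)) ,
    λ { x (x′ ∷ u) y len t → trans (split x (x′ ∷ u) y t)
          (rearrange (lam x (x′ ∷ u)) _ (lam x′ (u ∷ʳ y)) (g y) _ _
            (eq x′ u y (suc-injective len) (T-suffix [ x ] _ t))) }
    where
    open BoolSolver.xor-∧-Solver renaming (solve to solve′)
    rearrange : ∀ l r m g k k′ → r xor m ≡ g xor (k xor k′) → l xor r ≡ g xor ((l xor k) xor (m xor k′))
    rearrange l r m g k k′ e =
      trans (solve′ 3 (λ l r m → l :+ r := (l :+ m) :+ (r :+ m)) refl l r m)
      (trans (cong ((l xor m) xor_) e)
        (solve′ 5 (λ l m g k k′ → (l :+ m) :+ (g :+ (k :+ k′)) := g :+ ((l :+ k) :+ (m :+ k′))) refl l m g k k′))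

  along : (List A → Bool) → List A → List A → Bool
  along H s []      = false
  along H s (y ∷ q) = H (s ∷ʳ y) xor along H (s ∷ʳ y) q

  -- In `sum-along` the coboundary of `K` telescopes: the sum of `H` along a word is a linear
  -- functional of the word plus two boundary values, which by `local` see only the last `k`
  -- letters.
  record LetterPrimitive (k : ℕ) (H : List A → Bool) : Set (a ⊔ ℓ) where
    field
      g      : A → Bool
      K      : List A → Bool
      local  : ∀ p s → k ≤ length s → K (p ++ s) ≡ K s
      step   : ∀ s y → k ≤ length s → T (s ∷ʳ y) → H (s ∷ʳ y) ≡ g y xor (K s xor K (s ∷ʳ y))

    sum-along : ∀ s q → k ≤ length s → T (s ++ q) → along H s q ≡ par g q xor (K s xor K (s ++ q))
    sum-along s []      len t = sym (trans (cong (λ u → K s xor K u) (++-identityʳ s)) (xor-same (K s)))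
    sum-along s (y ∷ q) len t =
      trans (cong₂ _xor_ (step s y len (T-prefix _ q t′)) (sum-along (s ∷ʳ y) q len′ t′))
      (trans (solve′ 5 (λ g p k m n → (g :+ (k :+ m)) :+ (p :+ (m :+ n)) := (g :+ p) :+ (k :+ n)) refl
               (g y) (par g q) (K s) (K (s ∷ʳ y)) (K ((s ∷ʳ y) ++ q)))
        (cong (λ u → (g y xor par g q) xor (K s xor K u)) (++-assoc s [ y ] q)))
      where
      open BoolSolver.xor-∧-Solver renaming (solve to solve′)
      t′ : T ((s ∷ʳ y) ++ q)
      t′ = subst T (sym (++-assoc s [ y ] q)) t
      len′ : k ≤ length (s ∷ʳ y)
      len′ = ≤-trans len (subst (length s ≤_) (sym (length-++ s)) (m≤m+n _ 1))

  -- Here `H` reads the last `k + 2` letters, written `x u y` with `u` of length `k`. The function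
  -- `K` obtained for words of length `suc k` is then read off the last `suc k` letters of any
  -- longer word.
  letter-primitive : ∀ k (H : List A → Bool) → (∀ p s → suc k < length s → H (p ++ s) ≡ H s) →
                       LetterPrimitive (suc k) H
  letter-primitive k H H-local with g , K , eq ← letter-cohomologous k (λ x u y → H (x ∷ u ∷ʳ y)) =
    record { g = g ; K = K̂ ; local = local ; step = step }
    where
    K̂ : List A → Bool
    K̂ s = K (drop (length s ∸ suc k) s)

    K̂-suffix : ∀ p s → length s ≡ suc k → K̂ (p ++ s) ≡ K s
    K̂-suffix p s len = cong K (trans
      (cong (λ m → drop m (p ++ s))
        (trans (cong₂ _∸_ (length-++ p) (sym len)) (m+n∸n≡m (length p) (length s))))
      (drop-++ p))
      where
      drop-++ : ∀ p → drop (length p) (p ++ s) ≡ s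
      drop-++ []      = refl
      drop-++ (x ∷ p) = drop-++ p

    local : ∀ p s → suc k ≤ length s → K̂ (p ++ s) ≡ K̂ s
    local p s len with q , s′ , refl , len′ ← split-at-end (suc k) s len =
      trans (trans (cong K̂ (sym (++-assoc p q s′))) (K̂-suffix (p ++ q) s′ len′)) (sym (K̂-suffix q s′ len′))

    step : ∀ s y → suc k ≤ length s → T (s ∷ʳ y) → H (s ∷ʳ y) ≡ g y xor (K̂ s xor K̂ (s ∷ʳ y))
    step s y len t with q , x ∷ u , refl , len′ ← split-at-end (suc k) s len =
      trans (cong H (++-assoc q (x ∷ u) [ y ]))
      (trans (H-local q _ (s≤s (subst (suc k ≤_) (sym (length-++ u)) (≤-reflexive (trans (sym len′) (+-comm 1 (length u)))))))
      (trans (eq x u y (suc-injective len′) (T-suffix q _ (subst T (++-assoc q (x ∷ u) [ y ]) t)))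
        (cong (g y xor_) (cong₂ _xor_ (sym (K̂-suffix q (x ∷ u) len′))
          (sym (trans (cong K̂ eq′) (K̂-suffix (q ∷ʳ x) (u ∷ʳ y)
            (trans (length-++ u) (trans (+-comm _ 1) len′)))))))))
      where
      eq′ : (q ++ x ∷ u) ∷ʳ y ≡ (q ∷ʳ x) ++ (u ∷ʳ y)
      eq′ = trans (++-assoc q (x ∷ u) [ y ]) (sym (++-assoc q [ x ] (u ∷ʳ y)))

  -- Return words

  -- f enumerates the right first return words to w without repetition.
  record Returns {i} {I : Set i} (w : List A) (f : I → List A) : Set (a ⊔ ℓ ⊔ i) where
    field
      in-T      : ∀ i → T (w ++ f i)
      ends      : ∀ i → Ends w (w ++ f i)
      nonempty  : Nonempty f
      first     : ∀ i p q → f i ≡ p ++ q → p ≢ [] → q ≢ [] → ¬ Ends w (w ++ p)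
      injective : ∀ i j → f i ≡ f j → i ≡ j
      complete  : ∀ q → T (w ++ q) → q ≢ [] → Ends w (w ++ q) → ∃[ i ] ∃[ p ] (q ≡ f i ++ p)

    -- A proper prefix `f i` of `f j` would be an earlier return to `w`.
    prefixCode : PrefixCode f
    prefixCode i j []      eq = injective i j (sym (trans eq (++-identityʳ _)))
    prefixCode i j (x ∷ z) eq = contradiction (ends i) (first j (f i) (x ∷ z) eq (nonempty i) λ ())

    ends⋆ : ∀ k {s} → Ends w s → Ends w (s ++ concatMap f k)
    ends⋆ []      {s} h = subst (Ends w) (sym (++-identityʳ s)) h
    ends⋆ (i ∷ k) (p , refl) =
      subst (Ends w) (trans (cong (_++ concatMap f k) (sym (++-assoc p w (f i)))) (++-assoc (p ++ w) (f i) _))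
        (ends⋆ k (ends-++ p (ends i)))

    -- Split off the return word found by `complete`; since `w f i` ends with `w`, the rest of `q`
    -- follows an occurrence of `w` again.
    decode-bounded : ∀ b q → length q ≤ b → T (w ++ q) → Ends w (w ++ q) → Generated f q
    decode-bounded b       []        _   t h = [] , refl
    decode-bounded (suc b) q@(_ ∷ _) len t h with complete q t (λ ()) h
    ... | i , p , eq = tail (ends i)
      where
      tail : Ends w (w ++ f i) → Generated f q
      tail (v , eq′) = prepend (decode-bounded b p
          (≤-pred (≤-trans (+-monoˡ-≤ (length p) (≢[]⇒length>0 (nonempty i)))
            (≤-trans (≤-reflexive (trans (sym (length-++ (f i))) (cong length (sym eq)))) len)))
          (T-suffix v (w ++ p) (subst T eq‴ t))
          (ends-drop v (w ++ p) (subst (length w ≤_) (sym (length-++ w)) (m≤m+n _ _)) (subst (Ends w) eq‴ h)))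
        where
        prepend : Generated f p → Generated f q
        prepend (k , eq″) = i ∷ k , trans eq (cong (f i ++_) eq″)
        eq‴ : w ++ q ≡ v ++ (w ++ p)
        eq‴ = trans (cong (w ++_) eq) (trans (sym (++-assoc w (f i) p))
                (trans (cong (_++ p) eq′) (++-assoc v w p)))

    decode : ∀ {s} q → Ends w s → T (s ++ q) → Ends w (s ++ q) → Generated f q
    decode q (v , refl) t h = decode-bounded (length q) q ≤-refl
      (T-suffix v (w ++ q) (subst T (++-assoc v w q) t))
      (ends-drop v (w ++ q) (subst (length w ≤_) (sym (length-++ w)) (m≤m+n _ _))
        (subst (Ends w) (++-assoc v w q) h))

  returns-[] : Returns [] [_]
  returns-[] = record
    { in-T      = letter
    ; ends      = λ i → [ i ] , refl
    ; nonempty  = λ i ()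
    ; first     = λ { i [] q eq p≢ q≢ → contradiction refl p≢
                    ; i (x ∷ []) [] eq p≢ q≢ → contradiction refl q≢
                    ; i (x ∷ []) (_ ∷ _) () p≢ q≢
                    ; i (x ∷ _ ∷ _) q () p≢ q≢ }
    ; injective = λ { i j refl → refl }
    ; complete  = λ { [] t q≢ h → contradiction refl q≢ ; (x ∷ q) t q≢ h → x , q , refl }
    }

  -- Finiteness and enumeration of the return words

  alphabet : List A
  alphabet = tabulate (Inverse.from ι)

  ∈-alphabet : ∀ x → x ∈ alphabet
  ∈-alphabet x = subst (_∈ alphabet) (Inverse.strictlyInverseʳ ι x) (∈-tabulate⁺ {f = Inverse.from ι} (Inverse.to ι x))

  words≤ : ℕ → List (List A)
  words≤ zero    = [ [] ]
  words≤ (suc k) = [] ∷ concatMap (λ x → map (x ∷_) (words≤ k)) alphabet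

  ∈-words≤ : ∀ k u → length u ≤ k → u ∈ words≤ k
  ∈-words≤ zero    []      _         = here refl
  ∈-words≤ (suc k) []      _         = here refl
  ∈-words≤ (suc k) (x ∷ u) (s≤s len) = there (∈-concatMap⁺ (λ x → map (x ∷_) (words≤ k))
    (Any.map (λ { refl → ∈-map⁺ (x ∷_) (∈-words≤ k u len) }) (∈-alphabet x)))

  lookup-injective : ∀ {b} {B : Set b} {xs : List B} → Unique xs → ∀ i j → lookup xs i ≡ lookup xs j → i ≡ j
  lookup-injective (_ ∷ _)  zero    zero    _  = refl
  lookup-injective (p ∷ _)  zero    (suc j) eq = contradiction eq (All.lookup p (∈-lookup j))
  lookup-injective (p ∷ _)  (suc i) zero    eq = contradiction (sym eq) (All.lookup p (∈-lookup i))
  lookup-injective (_ ∷ u)  (suc i) (suc j) eq = cong suc (lookup-injective u i j eq)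

  module ReturnWords (w : List A) (w≢[] : w ≢ []) (tw : T w) where

    -- A decidable form of `first`. The last letter goes unchecked because the full word is allowed
    -- to end with `w`.
    NoReturn : List A → List A → Set a
    NoReturn s []          = Lift a ⊤
    NoReturn s (x ∷ [])    = Lift a ⊤
    NoReturn s (x ∷ y ∷ r) = ¬ Ends w (s ∷ʳ x) × NoReturn (s ∷ʳ x) (y ∷ r)

    noReturn? : ∀ s r → Dec (NoReturn s r)
    noReturn? s []          = yes _
    noReturn? s (x ∷ [])    = yes _
    noReturn? s (x ∷ y ∷ r) = ¬? (ends? _≟_ w (s ∷ʳ x)) ×-dec noReturn? (s ∷ʳ x) (y ∷ r)

    noReturn-prefix : ∀ s p q → NoReturn s (p ++ q) → p ≢ [] → q ≢ [] → ¬ Ends w (s ++ p)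
    noReturn-prefix s []           q       nr       p≢ q≢ = contradiction refl p≢
    noReturn-prefix s (x ∷ [])     []      nr       p≢ q≢ = contradiction refl q≢
    noReturn-prefix s (x ∷ [])     (_ ∷ _) (h , _)  p≢ q≢ = h
    noReturn-prefix s (x ∷ y ∷ p)  q       (_ , nr) p≢ q≢ =
      noReturn-prefix (s ∷ʳ x) (y ∷ p) q nr (λ ()) q≢ ∘ subst (Ends w) (sym (++-assoc s [ x ] (y ∷ p)))

    first-return : ∀ s q → q ≢ [] → Ends w (s ++ q) →
                   ∃[ p ] ∃[ p′ ] (q ≡ p ++ p′ × p ≢ [] × Ends w (s ++ p) × NoReturn s p)
    first-return s []      q≢ h = contradiction refl q≢
    first-return s (x ∷ q) q≢ h with ends? _≟_ w (s ∷ʳ x)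
    ... | yes h′ = [ x ] , q , refl , (λ ()) , h′ , _
    first-return s (x ∷ [])    q≢ h | no ¬h = contradiction h ¬h
    first-return s (x ∷ y ∷ q) q≢ h | no ¬h
      with first-return (s ∷ʳ x) (y ∷ q) (λ ()) (subst (Ends w) (sym (++-assoc s [ x ] (y ∷ q))) h)
    ... | []    , _  , _  , p≢ , _  , _  = contradiction refl p≢
    ... | z ∷ p , p′ , eq , p≢ , h′ , nr =
          x ∷ z ∷ p , p′ , cong (x ∷_) eq , (λ ()) , subst (Ends w) (++-assoc s [ x ] (z ∷ p)) h′ , ¬h , nr

    IsReturn : List A → Set (a ⊔ ℓ)
    IsReturn r = r ≢ [] × T (w ++ r) × Ends w (w ++ r) × NoReturn w r

    isReturn? : ∀ r → Dec (IsReturn r)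
    isReturn? r = ¬? (≡-dec _≟_ r []) ×-dec T? (w ++ r) ×-dec ends? _≟_ w (w ++ r) ×-dec noReturn? w r

    bound : ℕ
    bound = proj₁ (occurs w tw)

    -- In a longer `r` the prefix of length `bound` contains `w`, so `w` would be met again before
    -- the end of `r`.
    isReturn-bound : ∀ r → IsReturn r → length r ≤ bound
    isReturn-bound r (_ , t , _ , nr) = ≮⇒≥ λ long → short (split-at bound r (<⇒≤ long)) long
      where
      short : ∃[ r₁ ] ∃[ r₂ ] (r ≡ r₁ ++ r₂ × length r₁ ≡ bound) → ¬ bound < length r
      short (r₁ , r₂ , refl , len) long
        with p , q , refl ← proj₂ (occurs w tw) r₁ (T-factor w r₁ r₂ t) (≤-reflexive (sym len)) =
          noReturn-prefix w (p ++ w) (q ++ r₂)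
            (subst (NoReturn w) (trans (++-assoc p (w ++ q) r₂) (trans (cong (p ++_) (++-assoc w q r₂)) (sym (++-assoc p w (q ++ r₂))))) nr)
            (λ eq → w≢[] (++-conicalʳ p w eq))
            (λ eq → contradiction (subst (λ u → bound < length u) (trans (cong ((p ++ w ++ q) ++_) (++-conicalʳ q r₂ eq)) (++-identityʳ (p ++ w ++ q))) long)
                      (≤⇒≯ (≤-reflexive len)))
            (ends-++ w (p , refl))

    returnList : List (List A)
    returnList = deduplicate (≡-dec _≟_) (filter isReturn? (words≤ bound))

    returns : Returns w (lookup returnList)
    returns = record
      { in-T      = λ i → proj₁ (proj₂ (isReturn i))
      ; ends      = λ i → proj₁ (proj₂ (proj₂ (isReturn i)))
      ; nonempty  = λ i → proj₁ (isReturn i)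
      ; first     = λ i p q eq p≢ q≢ →
          noReturn-prefix w p q (subst (NoReturn w) eq (proj₂ (proj₂ (proj₂ (isReturn i))))) p≢ q≢
      ; injective = lookup-injective (deduplicate-! (≡-dec _≟_) (filter isReturn? (words≤ bound)))
      ; complete  = complete
      }
      where
      isReturn : ∀ i → IsReturn (lookup returnList i)
      isReturn i = proj₂ (∈-filter⁻ isReturn? {xs = words≤ bound}
        (∈-deduplicate⁻ (≡-dec _≟_) (filter isReturn? (words≤ bound)) (∈-lookup i)))
      complete : ∀ q → T (w ++ q) → q ≢ [] → Ends w (w ++ q) → ∃[ i ] ∃[ p ] (q ≡ lookup returnList i ++ p)
      complete q t q≢ h with p , p′ , refl , p≢ , h′ , nr ← first-return w q q≢ h =
        Any.index p∈ , p′ , cong (_++ p′) (lookup-index p∈)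
        where
        ret : IsReturn p
        ret = p≢ , T-prefix (w ++ p) p′ (subst T (sym (++-assoc w p p′)) t) , h′ , nr
        p∈ : p ∈ returnList
        p∈ = ∈-deduplicate⁺ (≡-dec _≟_) (∈-filter⁺ isReturn? (∈-words≤ bound p (isReturn-bound p ret)) ret)

  -- Return words are independent modulo 2

  finite-bound : ∀ {m} (f : Fin m → ℕ) → ∃[ b ] (∀ j → f j ≤ b)
  finite-bound {zero}  f = 0 , λ ()
  finite-bound {suc m} f with b , h ← finite-bound (f ∘ suc) =
    f zero + b , λ { zero → m≤m+n (f zero) b ; (suc j) → ≤-trans (h j) (m≤n+m b (f zero)) }

  -- Linear independence of the abelianised words f i over the field with two elements, in dual form.
  Independent : ∀ {b} {B : Set b} → (B → List A) → Set (a ⊔ b)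
  Independent {B = B} f = ∀ (φ : B → Bool) → Σ[ g ∈ (A → Bool) ] (∀ i → par g (f i) ≡ φ i)

  along-cong : ∀ (H : List A → Bool) s s′ q → (∀ p → p ≢ [] → H (s ++ p) ≡ H (s′ ++ p)) → along H s q ≡ along H s′ q
  along-cong H s s′ []      h = refl
  along-cong H s s′ (y ∷ q) h = cong₂ _xor_ (h [ y ] λ ()) (along-cong H (s ∷ʳ y) (s′ ∷ʳ y) q
    λ p p≢ → trans (cong H (++-assoc s [ y ] p)) (trans (h (y ∷ p) λ ()) (cong H (sym (++-assoc s′ [ y ] p)))))

  along-last : ∀ (H : List A → Bool) s q → q ≢ [] →
               (∀ p q′ → q ≡ p ++ q′ → p ≢ [] → q′ ≢ [] → H (s ++ p) ≡ false) → along H s q ≡ H (s ++ q)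
  along-last H s []          q≢ h = contradiction refl q≢
  along-last H s (y ∷ [])    q≢ h = xor-identityʳ _
  along-last H s (y ∷ x ∷ q) q≢ h = trans (cong (_xor along H (s ∷ʳ y) (x ∷ q)) (h [ y ] (x ∷ q) refl (λ ()) (λ ())))
    (trans (along-last H (s ∷ʳ y) (x ∷ q) (λ ())
        (λ p q′ eq p≢ q′≢ → trans (cong H (++-assoc s [ y ] p)) (h (y ∷ p) q′ (cong (y ∷_) eq) (λ ()) q′≢)))
      (cong H (++-assoc s [ y ] (x ∷ q))))

  module Independence {m} {w : List A} {f : Fin m → List A} (R : Returns w f) where
    private module R = Returns R

    -- An occurrence of `w` strictly between the first and the last one in `w f j` would be a return
    -- completed inside `f j`, against `first`.
    no-overlap : ∀ j q p → w ++ f j ≡ q ++ w ++ p → p ≢ [] → q ≡ []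
    no-overlap j q p eq p≢ with levi w (q ++ w) (trans eq (sym (++-assoc q w p)))
    ... | inj₂ ([] , eq′ , _) = ++-cancelʳ w q [] (trans eq′ (++-identityʳ w))
    ... | inj₂ (x ∷ e , eq′ , eq″) = contradiction (q , sym eq′) (R.first j (x ∷ e) p eq″ (λ ()) p≢)
    ... | inj₁ (e , eq′ , _) = ++-conicalˡ q e (++-cancelʳ w _ _ (lengths q e eq′))
      where
      lengths : ∀ q e → w ≡ (q ++ w) ++ e → (q ++ e) ++ w ≡ [] ++ w
      lengths []      []      _ = refl
      lengths []      (x ∷ e) h = contradiction (cong length h) (<⇒≢ (subst (length w <_) (sym (length-++ w)) (m<m+n _ (s≤s z≤n))))
      lengths (x ∷ q) e       h = contradiction (cong length h) (<⇒≢ (s≤s (subst (length w ≤_)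
        (sym (trans (length-++ (q ++ w)) (cong (_+ length e) (length-++ q)))) (≤-trans (m≤n+m _ (length q)) (m≤m+n _ _)))))

    Mark : List A → Fin m → Set a
    Mark s j = Ends (w ++ f j) s

    -- If `w f j` were longer than `w p`, it would have the suffix `w p`, hence an intermediate
    -- occurrence of `w`, which `no-overlap` excludes.
    mark-local : ∀ v p j → p ≢ [] → Mark (v ++ w ++ p) j → Mark (w ++ p) j
    mark-local v p j p≢ h with ≤-total (length (w ++ f j)) (length (w ++ p))
    ... | inj₁ le = ends-common le h (v , refl)
    ... | inj₂ ge with q , eq ← ends-common ge (v , refl) h with refl ← no-overlap j q p eq p≢ = [] , sym eq

    mark-unique : ∀ s i j → Mark s i → Mark s j → i ≡ j
    mark-unique s i j hi (p , refl) with q , eq ← mark-local p (f j) i (R.nonempty j) hi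
      with refl ← no-overlap j q (f i) eq (R.nonempty i) = R.injective i j (++-cancelˡ w _ _ (sym eq))

    module _ (φ : Fin m → Bool) where

      -- Summed along a word, `H` adds up the values of `φ` at the return words completed on the
      -- way. A primitive of `H` turns this sum into a linear functional of the word.
      H : List A → Bool
      H s with Finₚ.any? (λ j → ends? _≟_ (w ++ f j) s)
      ... | yes (j , _) = φ j
      ... | no _        = false

      H-mark : ∀ s j → Mark s j → H s ≡ φ j
      H-mark s j h with Finₚ.any? (λ j → ends? _≟_ (w ++ f j) s)
      ... | yes (i , h′) = cong φ (mark-unique s i j h′ h)
      ... | no ¬h        = contradiction (j , h) ¬h

      H-unmarked : ∀ s → (∀ j → ¬ Mark s j) → H s ≡ false
      H-unmarked s ¬h with Finₚ.any? (λ j → ends? _≟_ (w ++ f j) s)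
      ... | yes (j , h) = contradiction h (¬h j)
      ... | no _        = refl

      H-cong : ∀ s s′ → (∀ j → Mark s j → Mark s′ j) → (∀ j → Mark s′ j → Mark s j) → H s ≡ H s′
      H-cong s s′ to from with Finₚ.any? (λ j → ends? _≟_ (w ++ f j) s)
      ... | yes (j , h) = sym (H-mark s′ j (to j h))
      ... | no ¬h       = sym (H-unmarked s′ λ j h → ¬h (j , from j h))

      H-context : ∀ v p → p ≢ [] → H ((v ++ w) ++ p) ≡ H (w ++ p)
      H-context v p p≢ = trans (cong H (++-assoc v w p))
        (H-cong (v ++ w ++ p) (w ++ p) (λ j → mark-local v p j p≢) (λ j → ends-++ v))

      H-context₂ : ∀ v z p → Ends w z → p ≢ [] → H ((v ++ z) ++ p) ≡ H (z ++ p)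
      H-context₂ v z p (z₀ , refl) p≢ =
        trans (cong (λ u → H (u ++ p)) (sym (++-assoc v z₀ w))) (trans (H-context (v ++ z₀) p p≢) (sym (H-context z₀ p p≢)))

      k : ℕ
      k = proj₁ (finite-bound (λ j → length (w ++ f j)))

      H-local : ∀ p s → suc k < length s → H (p ++ s) ≡ H s
      H-local p s len = H-cong (p ++ s) s
        (λ j → ends-drop p s (≤-trans (proj₂ (finite-bound (λ j → length (w ++ f j))) j) (≤-trans (n≤1+n k) (<⇒≤ len))))
        (λ j → ends-++ p)

      open LetterPrimitive (letter-primitive k H H-local)

      N : ℕ
      -- A context `z₁ z₂` of this length has a side of length at least `suc k`, which is as far as
      -- `K` looks.
      N = suc k + suc k

      _∼_ : Rel (List A) _
      s ∼ s′ = K s ≡ K s′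

      ∼-equivalence : IsEquivalence _∼_
      ∼-equivalence = record { refl = refl ; sym = sym ; trans = trans }

      open Descent (Ends w) (λ x z → ends-++ [ x ]) {_∼_} ∼-equivalence N N ≤-refl

      -- If `z₁` is long, `K` sees only `z₁`. If `z₂` is long, sum `H` along `z₂`: the final value
      -- of `K` sees only `z₂`, and the sum is independent of `v` because `z₁` ends with `w`, so the
      -- initial value of `K` is independent of `v` too.
      base : ∀ z₁ z₂ → Ends w z₁ → N ≤ length (z₁ ++ z₂) → Determined z₁ z₂
      base z₁ z₂ h len v v′ lv lv′ t t′ with suc k ≤? length z₁
      ... | yes le = trans (local v z₁ le) (sym (local v′ z₁ le))
      ... | no ¬le = xor-cancelʳ (K z₂) (xor-cancelˡ (par g z₂) (trans (sym (tot v lv t)) (trans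
                       (along-cong H (v ++ z₁) (v′ ++ z₁) z₂
                         (λ p p≢ → trans (H-context₂ v z₁ p h p≢) (sym (H-context₂ v′ z₁ p h p≢))))
                       (tot v′ lv′ t′))))
        where
        le₂ : suc k ≤ length z₂
        le₂ = ≮⇒≥ λ lt → <⇒≱ (+-mono-<-≤ (≰⇒> ¬le) (<⇒≤ lt)) (subst (N ≤_) (length-++ z₁) len)
        xor-cancelʳ : ∀ z {x y} → x xor z ≡ y xor z → x ≡ y
        xor-cancelʳ z {x} {y} eq = xor-cancelˡ z (trans (xor-comm z x) (trans eq (xor-comm y z)))
        tot : ∀ v → N ≤ length (v ++ z₁) → T ((v ++ z₁) ++ z₂) →
              along H (v ++ z₁) z₂ ≡ par g z₂ xor (K (v ++ z₁) xor K z₂)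
        tot v lv t = trans (sum-along (v ++ z₁) z₂ (≤-trans (m≤m+n (suc k) (suc k)) lv) t)
          (cong (λ b → par g z₂ xor (K (v ++ z₁) xor b)) (local (v ++ z₁) z₂ le₂))

      -- Along `f j` the function `H` can be nonzero only at the end, where it equals `φ j`. The
      -- boundary values of `K` cancel, since both are taken at long words ending with `w`, to which
      -- `determined` applies.
      recover : ∀ j → par g (f j) ≡ φ j
      recover j with v , len , t ← extendˡ N (w ++ f j) (R.in-T j) | q , eq ← R.ends j =
        trans (sym (trans (sum-along (v ++ w) (f j) (≤-trans (m≤m+n (suc k) (suc k)) long) t₁)
          (trans (cong (λ b → par g (f j) xor (K (v ++ w) xor b)) (sym same))
          (trans (cong (par g (f j) xor_) (xor-same (K (v ++ w)))) (xor-identityʳ _)))))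
        (trans (along-cong H (v ++ w) w (f j) (H-context v))
        (trans (along-last H w (f j) (R.nonempty j) λ p q′ e p≢ q′≢ → H-unmarked (w ++ p)
          λ i h → R.first j p q′ e p≢ q′≢ (ends-trans (R.ends i) h))
        (H-mark (w ++ f j) j ([] , refl))))
        where
        t₁ : T ((v ++ w) ++ f j)
        t₁ = subst T (sym (++-assoc v w (f j))) t
        long : N ≤ length (v ++ w)
        long = subst (N ≤_) (sym (length-++ v)) (≤-trans (≤-reflexive (sym len)) (m≤m+n _ _))
        eq₂ : (v ++ w) ++ f j ≡ (v ++ q) ++ w
        eq₂ = trans (++-assoc v w (f j)) (trans (cong (v ++_) eq) (sym (++-assoc v q w)))
        same : K (v ++ w) ≡ K ((v ++ w) ++ f j)
        same = trans (determined base w [] ([] , refl) v (v ++ q) long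
                 (subst (N ≤_) (cong length eq₂) (subst (N ≤_) (sym (length-++ (v ++ w))) (≤-trans long (m≤m+n _ _))))
                 (subst T (sym (++-identityʳ (v ++ w))) (T-prefix (v ++ w) (f j) t₁))
                 (subst T (trans eq₂ (sym (++-identityʳ _))) t₁))
               (cong K (sym eq₂))

    independent : Independent f
    independent φ = _ , recover φ

  -- Bifix codes decoding the returns to a longer word

  ⇔-via : ∀ {p q r} {P : Set p} {Q : Set q} {R : Set r} → P ⇔ Q → R ⇔ Q → P ⇔ R
  ⇔-via f g = mk⇔ (Equivalence.from g ∘ Equivalence.to f) (Equivalence.from f ∘ Equivalence.to g)

  returns-reindex : ∀ {m} {w : List A} {F : Fin m → List A} (π : Fin m → A) (π⁻¹ : A → Fin m) →
                    (∀ i → π (π⁻¹ i) ≡ i) → (∀ j → π⁻¹ (π j) ≡ j) → Returns w F → Returns w (F ∘ π⁻¹)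
  returns-reindex {w = w} {F} π π⁻¹ ππ⁻¹ π⁻¹π R = record
    { in-T      = in-T ∘ π⁻¹
    ; ends      = ends ∘ π⁻¹
    ; nonempty  = nonempty ∘ π⁻¹
    ; first     = first ∘ π⁻¹
    ; injective = λ i j eq → trans (sym (ππ⁻¹ i)) (trans (cong π (injective _ _ eq)) (ππ⁻¹ j))
    ; complete  = λ q t q≢ h → reindex (complete q t q≢ h)
    }
    where
    open Returns R
    reindex : ∀ {q} → ∃[ j ] ∃[ p ] (q ≡ F j ++ p) → ∃[ i ] ∃[ p ] (q ≡ F (π⁻¹ i) ++ p)
    reindex (j , p , eq) = π j , p , trans eq (cong (λ j → F j ++ p) (sym (π⁻¹π j)))

  count : A → List A → ℕ
  count i = length ∘ filter (i ≟_)

  count-++ : ∀ i u v → count i (u ++ v) ≡ count i u + count i v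
  count-++ i u v = trans (cong length (filter-++ (i ≟_) u v)) (length-++ (filter (i ≟_) u))

  -- Both sides contain each letter equally often, and the contribution of `u` cancels.
  rotate-∈ : ∀ {i u} x y → u ++ x ≡ y ++ u → i ∈ y → i ∈ x
  rotate-∈ {i} {u} x y eq i∈y = nonzero (filter (i ≟_) x) refl
    (subst (0 <_) (+-cancelˡ-≡ (count i u) _ _ (trans (+-comm (count i u) (count i y))
      (trans (sym (count-++ i y u)) (trans (cong (count i) (sym eq)) (count-++ i u x)))))
      (∈⇒0< (∈-filter⁺ (i ≟_) i∈y refl)))
    where
    ∈⇒0< : ∀ {c} {xs : List A} → c ∈ xs → 0 < length xs
    ∈⇒0< (here _)  = s≤s z≤n
    ∈⇒0< (there _) = s≤s z≤n
    nonzero : ∀ xs → filter (i ≟_) x ≡ xs → 0 < length xs → i ∈ x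
    nonzero (c ∷ xs) e _ with c∈x , refl ← ∈-filter⁻ (i ≟_) {xs = x} (subst (c ∈_) (sym e) (here refl)) = c∈x

  Full : List A → Set a
  Full u = ∀ i → i ∈ u

  module Decoding {w W : List A} {f : A → List A} {m} {F : Fin m → List A}
                  (Rf : Returns w f) (RF : Returns W F) (tW : T W) (w⊑W : Ends w W) where
    private
      module Rf = Returns Rf
      module RF = Returns RF

    decoded : ∀ j → Generated f (F j)
    decoded j = Rf.decode (F j) w⊑W (RF.in-T j) (ends-trans w⊑W (RF.ends j))

    x : Fin m → List A
    x j = proj₁ (decoded j)

    F≡f⋆x : ∀ j → F j ≡ concatMap f (x j)
    F≡f⋆x j = proj₂ (decoded j)

    F⋆≡f⋆x⋆ : ∀ k → concatMap F k ≡ concatMap f (concatMap x k)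
    F⋆≡f⋆x⋆ k = trans (concatMap-cong F≡f⋆x k) (sym (concatMap-concatMap f x k))

    f⋆-injective : ∀ k k′ → concatMap f k ≡ concatMap f k′ → k ≡ k′
    f⋆-injective = concatMap-injective Rf.nonempty Rf.prefixCode

    -- Cutting points of the decoding by a bifix family

    module _ {X : Fin m → List A} (X-nonempty : Nonempty X) (prefix : PrefixCode X) (suffix : SuffixCode X)
             (x∈X : ∀ j → Generated X (x j)) where

      between : ∀ {s} q → Ends W s → T (s ++ q) → Ends W (s ++ q) → ∃[ y ] (q ≡ concatMap f y × Generated X y)
      between q h t h′ with k , refl ← RF.decode q h t h′ =
        concatMap x k , F⋆≡f⋆x⋆ k , generated-concatMap x∈X k

      between-generated : ∀ {s} y → Ends W s → T (s ++ concatMap f y) → Ends W (s ++ concatMap f y) → Generated X y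
      between-generated y h t h′ with y′ , eq , g ← between (concatMap f y) h t h′
        with refl ← f⋆-injective y y′ eq = g

      -- The end of `s` is a cutting point of the decoding by `X`, started at some occurrence of
      -- `W`.
      Cut : List A → Set a
      Cut s = ∃[ v ] ∃[ y ] (s ≡ (v ++ W) ++ concatMap f y × Generated X y)

      -- The choice of the occurrence of `W` is immaterial: two of them are separated by a word
      -- generated by `X`, which can be put in front or, as `X` is a prefix code, cancelled.
      cut⇔ : ∀ v y → T ((v ++ W) ++ concatMap f y) → Cut ((v ++ W) ++ concatMap f y) ⇔ Generated X y
      cut⇔ v y t = mk⇔ to λ g → v , y , refl , g
        where
        to : Cut ((v ++ W) ++ concatMap f y) → Generated X y
        to (v′ , y′ , eq , g) with levi (v ++ W) (v′ ++ W) eq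
        ... | inj₁ (e , eq₁ , eq₂)
              with y″ , refl , g″ ← between e (v′ , refl) (subst T eq₁ (T-prefix (v ++ W) _ t)) (v , sym eq₁)
              with refl ← f⋆-injective y′ (y″ ++ y) (trans eq₂ (sym (concatMap-++ f y″ y))) =
                generated-cancelˡ X-nonempty prefix g″ g
        ... | inj₂ (e , eq₁ , eq₂)
              with y″ , refl , g″ ← between e (v , refl) (subst T eq₁ (T-prefix (v′ ++ W) _ (subst T eq t))) (v′ , sym eq₁)
              with refl ← f⋆-injective y (y″ ++ y′) (trans eq₂ (sym (concatMap-++ f y″ y′))) =
                generated-++ g″ g

      N₀ : ℕ
      N₀ = proj₁ (occurs W tW)

      after-W : ∀ s → T s → N₀ ≤ length s → Ends w s → ∃[ p ] ∃[ y ] (s ≡ (p ++ W) ++ concatMap f y)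
      after-W s t len h with proj₂ (occurs W tW) s t len
      ... | p , q , eq with eq′ ← trans eq (sym (++-assoc p W q))
          with y , refl ← Rf.decode q (ends-++ p w⊑W) (subst T eq′ t) (subst (Ends w) eq′ h) = p , y , eq′

      _∼_ : Rel (List A) a
      s ∼ s′ = Cut s ⇔ Cut s′

      ∼-equivalence : IsEquivalence _∼_
      ∼-equivalence = record
        { refl  = mk⇔ id id
        ; sym   = λ e → mk⇔ (Equivalence.from e) (Equivalence.to e)
        ; trans = λ e e′ → mk⇔ (Equivalence.to e′ ∘ Equivalence.to e) (Equivalence.from e ∘ Equivalence.from e′)
        }

      -- One side of a context of length `N₀ + N₀` has length at least `N₀` and therefore contains
      -- `W`.
      open Descent (Ends w) (λ x z → ends-++ [ x ]) {_∼_} ∼-equivalence (N₀ + N₀) (N₀ + N₀) ≤-refl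

      -- If `W` occurs in `z₁`, decoding from there decides. Otherwise let `y₂` decode from the
      -- position to the end of a `W` in `z₂`. With `y` decoding from an earlier `W` to the
      -- position, `y y₂` is generated, so by the bifix property `y` is generated exactly if `y₂`
      -- is, and `y₂` does not depend on `v`.
      base : ∀ z₁ z₂ → Ends w z₁ → N₀ + N₀ ≤ length (z₁ ++ z₂) → Determined z₁ z₂
      base z₁ z₂ h len v v′ lv lv′ t t′ with N₀ ≤? length z₁
      ... | yes le with p , y , eq ← after-W z₁ (T-suffix v z₁ (T-prefix (v ++ z₁) z₂ t)) le h =
              ⇔-via (char v t) (char v′ t′)
        where
        char : ∀ v → T ((v ++ z₁) ++ z₂) → Cut (v ++ z₁) ⇔ Generated X y
        char v t = subst (λ s → Cut s ⇔ Generated X y) (sym eq′) (cut⇔ (v ++ p) y (subst T eq′ (T-prefix (v ++ z₁) z₂ t)))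
          where
          eq′ : v ++ z₁ ≡ ((v ++ p) ++ W) ++ concatMap f y
          eq′ = trans (cong (v ++_) eq) (trans (sym (++-assoc v (p ++ W) _)) (cong (_++ concatMap f y) (sym (++-assoc v p W))))
      ... | no ¬le with a , b , refl ← proj₂ (occurs W tW) z₂ (T-suffix (v ++ z₁) z₂ t)
                (≮⇒≥ λ lt → <⇒≱ (+-mono-<-≤ (≰⇒> ¬le) (<⇒≤ lt)) (subst (N₀ + N₀ ≤_) (length-++ z₁) len))
          with y₂ , eq₂ ← Rf.decode (a ++ W) h (T-prefix (z₁ ++ a ++ W) b (T-suffix v _ (subst T (assoc₁ v z₁ a W b) t)))
                 (subst (Ends w) (++-assoc z₁ a W) (ends-++ (z₁ ++ a) w⊑W)) =
            ⇔-via (char v lv t) (char v′ lv′ t′)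
        where
        char : ∀ v → N₀ + N₀ ≤ length (v ++ z₁) → T ((v ++ z₁) ++ (a ++ W ++ b)) → Cut (v ++ z₁) ⇔ Generated X y₂
        char v lv t with p , y , eq ← after-W (v ++ z₁) (T-prefix (v ++ z₁) _ t) (≤-trans (m≤m+n N₀ N₀) lv) (ends-++ v h) =
          ⇔-via (subst (λ s → Cut s ⇔ Generated X y) (sym eq) (cut⇔ p y (subst T eq (T-prefix (v ++ z₁) _ t))))
                (mk⇔ (λ g₂ → generated-cancelʳ X-nonempty suffix g₂ both) (λ g → generated-cancelˡ X-nonempty prefix g both))
          where
          eq′ : (v ++ z₁) ++ (a ++ W) ≡ (p ++ W) ++ concatMap f (y ++ y₂)
          eq′ = trans (cong₂ _++_ eq eq₂) (trans (++-assoc (p ++ W) _ _) (cong ((p ++ W) ++_) (sym (concatMap-++ f y y₂))))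
          both : Generated X (y ++ y₂)
          both = between-generated (y ++ y₂) (p , refl) (subst T eq′ (T-prefix _ b (subst T (assoc₂ (v ++ z₁) a W b) t)))
                   (subst (Ends W) eq′ (ends-++ (v ++ z₁) (a , refl)))

      -- By `determined` with the context `w` alone, all long words ending with `w` behave alike,
      -- and `u W` is a cut with nothing left to decode.
      long-cut : ∀ s → T s → N₀ + N₀ ≤ length s → Ends w s → Cut s
      long-cut s t len (v , refl) with u , len′ , t′ ← extendˡ (N₀ + N₀) W tW =
        Equivalence.to (determined base w [] ([] , refl) (u ++ proj₁ w⊑W) v
            (subst (N₀ + N₀ ≤_) (cong length eq′) (subst (N₀ + N₀ ≤_) (sym (length-++ u)) (≤-trans (≤-reflexive (sym len′)) (m≤m+n _ _))))
            len (subst T (trans eq′ (sym (++-identityʳ _))) t′) (subst T (sym (++-identityʳ _)) t))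
          (u , [] , trans (sym eq′) (sym (++-identityʳ _)) , [] , refl)
        where
        eq′ : u ++ W ≡ (u ++ proj₁ w⊑W) ++ w
        eq′ = trans (cong (u ++_) (proj₂ w⊑W)) (sym (++-assoc u _ w))

      all-generated : ∀ y → T (W ++ concatMap f y) → Generated X y
      all-generated y t with u , len , t′ ← extendˡ (N₀ + N₀) _ t =
        Equivalence.to (cut⇔ u y t″) (long-cut _ t″
          (subst (N₀ + N₀ ≤_) (trans (sym (length-++ u)) (cong length (sym (++-assoc u W _)))) (≤-trans (≤-reflexive (sym len)) (m≤m+n _ _)))
          (Rf.ends⋆ y (ends-++ u w⊑W)))
        where
        t″ : T ((u ++ W) ++ concatMap f y)
        t″ = subst T (sym (++-assoc u W _)) t′

      singleton-generated : ∀ i → Generated X [ i ] → ∃[ j ] (X j ≡ [ i ])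
      singleton-generated i (j ∷ k , eq) with X j in Xj
      ... | []    = contradiction Xj (X-nonempty j)
      ... | y ∷ z with refl ← ++-conicalˡ z _ (sym (proj₂ (∷-injective eq))) =
              j , trans Xj (cong [_] (sym (proj₁ (∷-injective eq))))

      -- Find `w f i` in a long right extension of `W`. The decodings `y` and `y i`, up to the end
      -- of this `w` and of its return, are both generated, so `y` can be cancelled.
      onto-letters : ∀ i → ∃[ j ] (X j ≡ [ i ])
      onto-letters i with occurs (w ++ f i) (Rf.in-T i)
      ... | N , found with q , len , t ← extendʳ N W tW with p , b , refl ← found q (T-suffix W q t) (≤-reflexive (sym len))
          with t₁ ← T-prefix ((W ++ p ++ w) ++ f i) b (subst T (assoc₃ W p w (f i) b) t)
          with y , eq ← Rf.decode (p ++ w) w⊑W (T-prefix (W ++ p ++ w) (f i) t₁)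
                 (subst (Ends w) (++-assoc W p w) (W ++ p , refl)) =
        singleton-generated i (generated-cancelˡ X-nonempty prefix
          (all-generated y (subst (λ u → T (W ++ u)) eq (T-prefix (W ++ p ++ w) (f i) t₁)))
          (all-generated (y ∷ʳ i) (subst T (trans (++-assoc W (p ++ w) (f i)) (cong (W ++_)
            (trans (cong (_++ f i) eq) (sym (concatMap-∷ʳ f y i))))) t₁)))

      -- The first letter of `X j` is itself a word of the family, and `X` is a prefix code.
      all-letters : ∀ j → ∃[ i ] (X j ≡ [ i ])
      all-letters j with X j in eq
      ... | []    = contradiction eq (X-nonempty j)
      ... | i ∷ z with j′ , eq′ ← onto-letters i
          with refl ← prefix j′ j z (trans eq (cong (_++ z) (sym eq′))) = i , trans (sym eq) eq′
    -- Reduction to a bifix code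

    _≟ᶠ_ : DecidableEquality (Fin m)
    _≟ᶠ_ = Finₚ._≟_

    Tame : (Fin m → List A) → Set a
    Tame X = ∃[ σs ] Σ[ π ∈ (Fin m → A) ] Σ[ π⁻¹ ∈ (A → Fin m) ]
             ((∀ j → X j ≡ eval σs [ π j ]) × (∀ i → π (π⁻¹ i) ≡ i) × (∀ j → π⁻¹ (π j) ≡ j))

    independent-nonempty : ∀ (X : Fin m → List A) → Independent X → Nonempty X
    independent-nonempty X ind j Xj≡[] with g , h ← ind (λ _ → true) with () ← trans (sym (cong (par g) Xj≡[])) (h j)

    independent-injective : ∀ (X : Fin m → List A) → Independent X → ∀ i j → X i ≡ X j → i ≡ j
    independent-injective X ind i j eq with i ≟ᶠ j
    ... | yes i≡j = i≡j
    ... | no i≢j with g , h ← ind (update _≟ᶠ_ (λ _ → false) i true)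
        with () ← trans (sym (update-same _≟ᶠ_ (λ _ → false) i true)) (trans (sym (h i)) (trans (cong (par g) eq)
                    (trans (h j) (update-other _≟ᶠ_ (λ _ → false) i true j (i≢j ∘ sym)))))

    Splits : List A → List A → List A → Set a
    Splits u v z = (u ≡ v ++ z) ⊎ (u ≡ z ++ v)

    module _ (X : Fin m → List A) (i j : Fin m) (i≢j : i ≢ j) (z : List A) (s : Splits (X j) (X i) z)
             (ind : Independent X) where

      X′ : Fin m → List A
      X′ = update _≟ᶠ_ X j z

      shorter : total (length ∘ X′) < total (length ∘ X)
      shorter = total-mono-< le j (subst (λ u → length u < length (X j)) (sym (update-same _≟ᶠ_ X j z)) z<)
        where
        nonempty-i : 0 < length (X i)
        nonempty-i = ≢[]⇒length>0 (independent-nonempty X ind i)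
        z< : length z < length (X j)
        z< = [ (λ eq → subst (length z <_) (sym (trans (cong length eq) (trans (length-++ (X i)) (+-comm (length (X i)) _)))) (m<m+n _ nonempty-i))
             , (λ eq → subst (length z <_) (sym (trans (cong length eq) (length-++ z))) (m<m+n _ nonempty-i)) ]′ s
        le : ∀ k → length (X′ k) ≤ length (X k)
        le k with k ≟ᶠ j
        ... | yes refl = <⇒≤ z<
        ... | no _     = ≤-refl

      -- Modulo 2, `X j` is the sum of `X i` and `z` for either order of the factors, so prescribing
      -- `φ j` at `z` means prescribing `φ i xor φ j` at `X j`.
      independent-update : Independent X′
      independent-update φ with g , h ← ind (update _≟ᶠ_ φ j (φ i xor φ j)) = g , λ k → ok k
        where
        ok : ∀ k → par g (X′ k) ≡ φ k
        ok k with k ≟ᶠ j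
        ... | no k≢j   = trans (h k) (update-other _≟ᶠ_ φ j _ k k≢j)
        ... | yes refl = xor-cancelˡ (φ i) (trans (cong (_xor par g z) (sym (trans (h i) (update-other _≟ᶠ_ φ j _ i i≢j))))
                           (trans (sym (split s)) (trans (h j) (update-same _≟ᶠ_ φ j _))))
          where
          split : Splits (X j) (X i) z → par g (X j) ≡ par g (X i) xor par g z
          split (inj₁ eq) = trans (cong (par g) eq) (par-++ g (X i) z)
          split (inj₂ eq) = trans (cong (par g) eq) (trans (par-++ g z (X i)) (xor-comm (par g z) _))

      generated-update : ∀ {u} → Generated X u → Generated X′ u
      generated-update (k , refl) = generated-concatMap each k
        where
        single : ∀ k u → X′ k ≡ u → Generated X′ u
        single k u eq = [ k ] , trans (sym eq) (sym (++-identityʳ _))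
        each : ∀ k → Generated X′ (X k)
        each k with k ≟ᶠ j
        ... | no k≢j   = single k (X k) (update-other _≟ᶠ_ X j z k k≢j)
        ... | yes refl = [ (λ eq → subst (Generated X′) (sym eq) (generated-++ gi gz))
                         , (λ eq → subst (Generated X′) (sym eq) (generated-++ gz gi)) ]′ s
          where
          gi : Generated X′ (X i)
          gi = single i (X i) (update-other _≟ᶠ_ X j z i i≢j)
          gz : Generated X′ z
          gz = single j z (update-same _≟ᶠ_ X j z)

      -- The new automorphism sends `π j` to the product of `π i` and `π j` in the order of the
      -- splitting. It acts on letters before `σs` does, hence stands last in the list.
      tame-update : Tame X′ → Tame X
      tame-update (σs , π , π⁻¹ , eq , ππ⁻¹ , π⁻¹π) = σs ∷ʳ (σ , elementary s) , π , π⁻¹ , eq′ , ππ⁻¹ , π⁻¹π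
        where
        image : Splits (X j) (X i) z → List A
        image (inj₁ _) = π i ∷ π j ∷ []
        image (inj₂ _) = π j ∷ π i ∷ []
        σ : Morphism A
        σ = update _≟_ [_] (π j) (image s)
        πi≢πj : π j ≢ π i
        πi≢πj e = i≢j (trans (sym (π⁻¹π i)) (trans (cong π⁻¹ (sym e)) (π⁻¹π j)))
        elementary : ∀ s → ElementaryPositive (update _≟_ [_] (π j) (image s))
        elementary s@(inj₁ _) = α̃ (π j) (π i) πi≢πj (update-same _≟_ [_] (π j) (image s)) (update-other _≟_ [_] (π j) (image s))
        elementary s@(inj₂ _) = α (π j) (π i) πi≢πj (update-same _≟_ [_] (π j) (image s)) (update-other _≟_ [_] (π j) (image s))
        eval-image : ∀ s → X j ≡ eval σs (image s)
        eval-image (inj₁ e) = trans e (trans (cong₂ _++_ (trans (sym (update-other _≟ᶠ_ X j z i i≢j)) (eq i)) (trans (sym (update-same _≟ᶠ_ X j z)) (eq j))) (sym (eval-++ σs [ π i ] [ π j ])))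
        eval-image (inj₂ e) = trans e (trans (cong₂ _++_ (trans (sym (update-same _≟ᶠ_ X j z)) (eq j)) (trans (sym (update-other _≟ᶠ_ X j z i i≢j)) (eq i))) (sym (eval-++ σs [ π j ] [ π i ])))
        eval-σ : ∀ k → X k ≡ eval σs (σ (π k))
        eval-σ k with k ≟ᶠ j
        ... | yes refl = trans (eval-image s) (cong (eval σs) (sym (update-same _≟_ [_] (π j) (image s))))
        ... | no k≢j   = trans (sym (update-other _≟ᶠ_ X j z k k≢j)) (trans (eq k) (cong (eval σs)
                           (sym (update-other _≟_ [_] (π j) (image s) (π k)
                             λ e → k≢j (trans (sym (π⁻¹π k)) (trans (cong π⁻¹ e) (π⁻¹π j)))))))
        eq′ : ∀ k → X k ≡ eval (σs ∷ʳ (σ , elementary s)) [ π k ]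
        eq′ k = trans (eval-σ k) (trans (cong (eval σs) (sym (++-identityʳ (σ (π k))))) (sym (eval-∷ʳ σs (σ , elementary s) [ π k ])))

    -- Each splitting lowers the total length. Independence keeps the words nonempty and distinct,
    -- and `gen` lets the analysis of cutting points apply at the bifix end point.
    tame-bounded : ∀ b X → total (length ∘ X) ≤ b → Independent X → (∀ j → Generated X (x j)) → Tame X
    tame-bounded b X le ind gen with Finₚ.any? (λ i → Finₚ.any? λ j → ¬? (i ≟ᶠ j) ×-dec prefix? _≟_ (X i) (X j))
                                | Finₚ.any? (λ i → Finₚ.any? λ j → ¬? (i ≟ᶠ j) ×-dec ends? _≟_ (X i) (X j))
    tame-bounded zero X le ind gen | yes (i , j , i≢j , z , eq) | _ = contradiction (≤-trans (shorter X i j i≢j z (inj₁ eq) ind) le) λ ()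
    tame-bounded (suc b) X le ind gen | yes (i , j , i≢j , z , eq) | _ =
      tame-update X i j i≢j z s ind (tame-bounded b _ (≤-pred (≤-trans (shorter X i j i≢j z s ind) le))
        (independent-update X i j i≢j z s ind) (generated-update X i j i≢j z s ind ∘ gen))
      where s = inj₁ eq
    tame-bounded zero X le ind gen | no _ | yes (i , j , i≢j , z , eq) = contradiction (≤-trans (shorter X i j i≢j z (inj₂ eq) ind) le) λ ()
    tame-bounded (suc b) X le ind gen | no _ | yes (i , j , i≢j , z , eq) =
      tame-update X i j i≢j z s ind (tame-bounded b _ (≤-pred (≤-trans (shorter X i j i≢j z s ind) le))
        (independent-update X i j i≢j z s ind) (generated-update X i j i≢j z s ind ∘ gen))
      where s = inj₂ eq
    tame-bounded b X le ind gen | no ¬prefix | no ¬suffix =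
      [] , (λ j → proj₁ (letters j)) , (λ i → proj₁ (onto i)) , (λ j → proj₂ (letters j)) ,
      (λ i → sym (proj₁ (∷-injective (trans (sym (proj₂ (onto i))) (proj₂ (letters (proj₁ (onto i)))))))) ,
      (λ j → independent-injective X ind _ j (trans (proj₂ (onto (proj₁ (letters j)))) (sym (proj₂ (letters j)))))
      where
      prefix : PrefixCode X
      prefix i j z eq with i ≟ᶠ j
      ... | yes i≡j = i≡j
      ... | no i≢j  = contradiction (i , j , i≢j , z , eq) ¬prefix
      suffix : SuffixCode X
      suffix i j z eq with i ≟ᶠ j
      ... | yes i≡j = i≡j
      ... | no i≢j  = contradiction (i , j , i≢j , z , eq) ¬suffix
      onto = onto-letters (independent-nonempty X ind) prefix suffix gen
      letters = all-letters (independent-nonempty X ind) prefix suffix gen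

    tame : Tame x
    tame = tame-bounded _ x ≤-refl x-independent λ j → [ j ] , sym (++-identityʳ (x j))
      where
      x-independent : Independent x
      x-independent φ with g , h ← Independence.independent RF φ =
        -- A functional on the words `F j` pulls back along `f` to one on the words `x j`.
        par g ∘ f , λ j → trans (sym (par-concatMap g f (x j))) (trans (cong (par g) (sym (F≡f⋆x j))) (h j))

    -- The occurrence of w f i in W is repeated at the end of W F j, shifted by the length of F j.
    x-contains : ∀ i p q → W ≡ (p ++ w) ++ (f i ++ q ++ w) → ∀ j → i ∈ x j
    x-contains i p q eq₁ j
      with Rf.decode (f i ++ q ++ w) (p , refl) (subst T eq₁ tW) (subst (Ends w) eq₁ w⊑W)
    ... | [] , eq₂ = contradiction (sym eq₂) (++≢[] (Rf.nonempty i))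
    ... | i′ ∷ k , eq₂ with refl , _ ← head-cancel Rf.nonempty Rf.prefixCode i i′ eq₂ = shifted (RF.ends j)
      where
      W-eq : W ≡ (p ++ w) ++ concatMap f (i ∷ k)
      W-eq = trans eq₁ (cong ((p ++ w) ++_) eq₂)

      shifted : Ends W (W ++ F j) → i ∈ x j
      shifted (q′ , eq₃) = compare (levi (p ++ w) (q′ ++ p ++ w)
          (trans (sym both) (trans eq₃ (trans (cong (q′ ++_) W-eq) (sym (++-assoc q′ (p ++ w) _))))))
        where
        both : W ++ F j ≡ (p ++ w) ++ concatMap f (i ∷ k ++ x j)
        both = trans (cong₂ _++_ W-eq (F≡f⋆x j)) (trans (++-assoc (p ++ w) _ _)
                 (cong ((p ++ w) ++_) (sym (concatMap-++ f (i ∷ k) (x j)))))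

        0<q′ : 0 < length q′
        0<q′ = subst (0 <_) (+-cancelˡ-≡ (length W) _ _ (trans (sym (length-++ W)) (trans (cong length eq₃)
                 (trans (length-++ q′) (+-comm (length q′) (length W)))))) (≢[]⇒length>0 (RF.nonempty j))

        compare : (∃[ e ] (p ++ w ≡ (q′ ++ p ++ w) ++ e × concatMap f (i ∷ k) ≡ e ++ concatMap f (i ∷ k ++ x j))) ⊎
                  (∃[ e ] (q′ ++ p ++ w ≡ (p ++ w) ++ e × concatMap f (i ∷ k ++ x j) ≡ e ++ concatMap f (i ∷ k))) →
                  i ∈ x j
        compare (inj₁ (e , e₁ , _)) = contradiction (cong length e₁) (<⇒≢ (subst (length (p ++ w) <_) (sym (length-++ (q′ ++ p ++ w)))
          (≤-trans (subst (length (p ++ w) <_) (sym (length-++ q′)) (m<n+m _ 0<q′)) (m≤m+n _ (length e)))))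
        compare (inj₂ (e , e₁ , e₂)) with Rf.decode e (p , refl)
          (subst T e₁ (T-prefix (q′ ++ p ++ w) (concatMap f (i ∷ k))
            (subst T (trans eq₃ (trans (cong (q′ ++_) W-eq) (sym (++-assoc q′ (p ++ w) _)))) (RF.in-T j))))
          (subst (Ends w) e₁ (ends-++ q′ (p , refl)))
        ... | y , refl = rotate y (concatMap-injective Rf.nonempty Rf.prefixCode (i ∷ k ++ x j) (y ++ i ∷ k)
                           (trans e₂ (sym (concatMap-++ f y (i ∷ k))))) e₁
          where
          rotate : ∀ y → i ∷ k ++ x j ≡ y ++ i ∷ k → q′ ++ p ++ w ≡ (p ++ w) ++ concatMap f y → i ∈ x j
          rotate [] _ e₁ = contradiction (cong length (trans (sym (++-identityʳ (p ++ w))) (sym e₁)))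
            (<⇒≢ (subst (length (p ++ w) <_) (sym (length-++ q′)) (m<n+m _ 0<q′)))
          -- Here `c` is `i`, and `x j` is a conjugate of `c ∷ y`.
          rotate (c ∷ y) h _ = rotate-∈ (x j) (c ∷ y) h (here (proj₁ (∷-injective h)))

    -- The block of automorphisms leading from `w` to `W`

    block : List (Elementary A)
    block = proj₁ tame

    private
      π : Fin m → A
      π = proj₁ (proj₂ tame)

      π⁻¹ : A → Fin m
      π⁻¹ = proj₁ (proj₂ (proj₂ tame))

      ππ⁻¹ : ∀ i → π (π⁻¹ i) ≡ i
      ππ⁻¹ = proj₁ (proj₂ (proj₂ (proj₂ (proj₂ tame))))

    x≡block : ∀ i → x (π⁻¹ i) ≡ eval block [ i ]
    x≡block i = trans (proj₁ (proj₂ (proj₂ (proj₂ tame))) (π⁻¹ i)) (cong (λ i → eval block [ i ]) (ππ⁻¹ i))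

    reindexed : A → List A
    reindexed = F ∘ π⁻¹

    returns-reindexed : Returns W reindexed
    returns-reindexed = returns-reindex π π⁻¹ ππ⁻¹ (proj₂ (proj₂ (proj₂ (proj₂ (proj₂ tame))))) RF

    reindexed-block : ∀ u → concatMap reindexed u ≡ concatMap f (eval block u)
    reindexed-block u = trans (concatMap-cong (λ i → trans (F≡f⋆x (π⁻¹ i)) (cong (concatMap f) (x≡block i))) u)
      (trans (sym (concatMap-concatMap f (λ i → eval block [ i ]) u)) (cong (concatMap f) (sym (eval-concatMap block u))))

    block-full : (∀ i → ∃[ p ] ∃[ q ] (W ≡ (p ++ w) ++ (f i ++ q ++ w))) → ∀ i → Full (eval block [ i ])
    block-full occ j i = subst (i ∈_) (x≡block j) (x-contains i (proj₁ (occ i)) (proj₁ (proj₂ (occ i))) (proj₂ (proj₂ (occ i))) (π⁻¹ j))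

  -- The sequence of stages

  record Stage : Set (a ⊔ ℓ) where
    field
      w       : List A
      w∈T     : T w
      f       : A → List A
      returns : Returns w f

  module NextStage (S : Stage) where
    open Stage S
    private module Rf = Returns returns

    occurrence-bound : ∃[ b ] (∀ k → proj₁ (occurs (w ++ f (Inverse.from ι k)) (Rf.in-T _)) ≤ b)
    occurrence-bound = finite-bound λ k → proj₁ (occurs (w ++ f (Inverse.from ι k)) (Rf.in-T _))

    left : ∃[ v ] (length v ≡ suc (proj₁ occurrence-bound) × T (v ++ w))
    -- The bound makes `v` contain every `w f i`; the extra letter keeps `v` nonempty even if the
    -- bound is zero.
    left = extendˡ (suc (proj₁ occurrence-bound)) w w∈T

    v : List A
    v = proj₁ left

    W : List A
    W = v ++ w

    tW : T W
    tW = proj₂ (proj₂ left)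

    longer : length w < length W
    longer = subst (length w <_) (sym (length-++ v))
      (subst (λ l → length w < l + length w) (sym (proj₁ (proj₂ left))) (s≤s (m≤n+m _ _)))

    contains : ∀ i → ∃[ p ] ∃[ q ] (v ≡ p ++ (w ++ f i) ++ q)
    contains i = subst (λ i → ∃[ p ] ∃[ q ] (v ≡ p ++ (w ++ f i) ++ q)) (Inverse.strictlyInverseʳ ι i)
      (proj₂ (occurs (w ++ f (Inverse.from ι k)) (Rf.in-T _)) v (T-prefix v w tW)
        (≤-trans (proj₂ occurrence-bound k) (≤-trans (n≤1+n _) (≤-reflexive (sym (proj₁ (proj₂ left)))))))
      where k = Inverse.to ι i

    W≢[] : W ≢ []
    W≢[] eq = contradiction (subst (λ u → length w < length u) eq longer) λ ()

    open ReturnWords W W≢[] tW using () renaming (returns to returns-W)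
    open Decoding returns returns-W tW (v , refl)

    next : Stage
    next = record { w = W ; w∈T = tW ; f = reindexed ; returns = returns-reindexed }

    σs : List (Elementary A)
    σs = block

    next-f : ∀ u → concatMap (Stage.f next) u ≡ concatMap f (eval σs u)
    next-f = reindexed-block

    σs-full : ∀ i → Full (eval σs [ i ])
    σs-full = block-full λ i → let p , q , eq = contains i in p , q , trans (cong (_++ w) eq) (assoc₄ p w (f i) q w)

  -- Concatenating the blocks

  identity : Elementary A
  identity = [_] , perm ↔-refl λ _ → refl

  open Stage

  record Successor (S : Stage) : Set (a ⊔ ℓ) where
    field
      stage      : Stage
      morphisms  : List (Elementary A)
      longer     : length (w S) < length (w stage)
      composite  : ∀ u → concatMap (f stage) u ≡ concatMap (f S) (eval morphisms u)
      full       : ∀ i → Full (eval morphisms [ i ])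

  abstract
    successor : ∀ S → Successor S
    successor S = record
      { stage = next ; morphisms = σs ; longer = longer ; composite = next-f ; full = σs-full }
      where open NextStage S

  module _ (S : Stage) where
    open Successor (successor S) public renaming (stage to next; morphisms to block)

  -- The automorphism to be emitted, those left in the current block, and the stage reached after the block.
  State : Set (a ⊔ ℓ)
  State = Elementary A × List (Elementary A) × Stage

  -- The identity in front keeps the blocks nonempty.
  load : Stage → State
  load S = identity , block S , next S

  advance : State → State
  advance (_ , []     , S) = load S
  advance (_ , σ ∷ σs , S) = σ , σs , S

  stream : State → ℕ → Morphism A
  stream (σ , _) zero    = proj₁ σ
  stream st      (suc r) = stream (advance st) r

  stream-elementary : ∀ st r → ElementaryPositive (stream st r)
  stream-elementary (σ , _) zero    = proj₂ σ
  stream-elementary st      (suc r) = stream-elementary (advance st) r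

  compose-advance : ∀ st r k u → compose (stream st) (suc r) k u ≡ compose (stream (advance st)) r k u
  compose-advance st r zero    u = refl
  compose-advance st r (suc k) u = cong (extend (stream (advance st) r)) (compose-advance st (suc r) k u)

  skip : ℕ → State → State
  skip zero    st = st
  skip (suc r) st = skip r (advance st)

  compose-skip : ∀ st r k u → compose (stream st) r k u ≡ compose (stream (skip r st)) 0 k u
  compose-skip st zero    k u = refl
  compose-skip st (suc r) k u = trans (compose-advance st r k u) (compose-skip (advance st) r k u)

  compose-block : ∀ σ σs S k u →
    compose (stream (σ , σs , S)) 0 (suc (length σs) + k) u ≡ eval (σ ∷ σs) (compose (stream (load S)) 0 k u)
  compose-block σ []       S k u = cong (extend (proj₁ σ)) (compose-advance (σ , [] , S) 0 k u)
  compose-block σ (τ ∷ σs) S k u = cong (extend (proj₁ σ))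
    (trans (compose-advance (σ , τ ∷ σs , S) 0 (suc (length σs) + k) u) (compose-block τ σs S k u))

  compose-+ : ∀ (τ : ℕ → Morphism A) r k l u → compose τ r (k + l) u ≡ compose τ r k (compose τ (r + k) l u)
  compose-+ τ r zero    l u = cong (λ r → compose τ r l u) (sym (+-identityʳ r))
  compose-+ τ r (suc k) l u = cong (extend (τ r))
    (trans (compose-+ τ (suc r) k l u) (cong (λ s → compose τ (suc r) k (compose τ s l u)) (sym (+-suc r k))))

  -- `T⊆Fac` needs the lower bound on the number of morphisms, `Fac⊆T` the one on the length of the
  -- word. Each block adds at least one to both, its identity counting as a morphism.
  reach : ∀ j S → ∃[ N ] ∃[ S′ ] (j ≤ N × j + length (w S) ≤ length (w S′) ×
          (∀ u → concatMap (f S′) u ≡ concatMap (f S) (compose (stream (load S)) 0 N u)))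
  reach zero    S = 0 , S , z≤n , ≤-refl , λ u → refl
  reach (suc j) S with N , S′ , j≤N , len , eq ← reach j (next S) =
    suc (length (block S)) + N , S′ , s≤s (≤-trans j≤N (m≤n+m N _)) ,
    ≤-trans (≤-reflexive (sym (+-suc j _))) (≤-trans (+-monoʳ-≤ j (longer S)) len) ,
    λ u → trans (eq u) (trans (composite S (compose (stream (load (next S))) 0 N u)) (cong (concatMap (f S))
      (sym (trans (compose-block identity (block S) (next S) N u) (concatMap-pure (eval (block S) (compose (stream (load (next S))) 0 N u)))))))

  stage₀ : Stage
  stage₀ = record { w = [] ; w∈T = T-[] ; f = [_] ; returns = returns-[] }

  σ : ℕ → Morphism A
  σ = stream (load stage₀)

  reach₀ : ∀ j → ∃[ N ] ∃[ S ] (j ≤ N × j ≤ length (w S) × (∀ u → concatMap (f S) u ≡ compose σ 0 N u))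
  reach₀ j with N , S , j≤N , len , eq ← reach j stage₀ =
    N , S , j≤N , ≤-trans (m≤m+n j 0) len , λ u → trans (eq u) (concatMap-pure (compose σ 0 N u))

  -- Full words and primitivity

  elementary-covers : ∀ {τ} → ElementaryPositive τ → ∀ y → ∃[ c ] (y ∈ τ c)
  elementary-covers (α x z x≢z eq other) y with y ≟ x
  ... | yes refl = x , subst (x ∈_) (sym eq) (here refl)
  ... | no y≢x   = y , subst (y ∈_) (sym (other y y≢x)) (here refl)
  elementary-covers (α̃ x z x≢z eq other) y with y ≟ x
  ... | yes refl = x , subst (x ∈_) (sym eq) (there (here refl))
  ... | no y≢x   = y , subst (y ∈_) (sym (other y y≢x)) (here refl)
  elementary-covers (perm π eq) y = Inverse.from π y ,
    subst (y ∈_) (sym (eq _)) (here (sym (Inverse.strictlyInverseˡ π y)))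

  -- Every `y` occurs in the image of some letter `c`, and a full word contains `c`.
  eval-full : ∀ (σs : List (Elementary A)) u → Full u → Full (eval σs u)
  eval-full []             u full = full
  eval-full ((τ , e) ∷ σs) u full y with c , y∈ ← elementary-covers e y =
    ∈-concatMap⁺ τ (Any.map (λ { refl → y∈ }) (eval-full σs u full c))

  -- From position `r`, finish the current block and run through one more. The latter maps letters
  -- to full words, and the remainder of the former preserves fullness.
  σ-primitive : Primitive σ
  σ-primitive r = r + k , m<m+n r (s≤s z≤n) ,
    λ x y → subst (y ∈_) (sym (trans (cong (λ k → compose σ r k [ x ]) (m+n∸m≡n r k)) (blocks x)))
              (eval-full (τ ∷ τs) _ (eval-full (identity ∷ []) _ (full S x)) y)
    where
    τ  = proj₁ (skip r (load stage₀))
    τs = proj₁ (proj₂ (skip r (load stage₀)))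
    S  = proj₂ (proj₂ (skip r (load stage₀)))
    k : ℕ
    k = suc (length τs) + (suc (length (block S)) + 0)
    blocks : ∀ x → compose σ r k [ x ] ≡ eval (τ ∷ τs) (eval (identity ∷ block S) [ x ])
    blocks x = trans (compose-skip (load stage₀) r k [ x ])
      (trans (compose-block τ τs S (suc (length (block S)) + 0) [ x ])
        (cong (eval (τ ∷ τs)) (compose-block identity (block S) (next S) 0 [ x ])))

  -- The factors of the images

  -- Extend `u` on both sides until `w` occurs left and right of it; the word from the end of the
  -- first `w` to the end of the second decodes.
  factor-of-image : ∀ (S : Stage) u → T u → ∃[ y ] (u isFactorOf concatMap (f S) y)
  factor-of-image S u t with N , found ← occurs (w S) (w∈T S)
    with v , len , t₁ ← extendˡ N u t
    with p , q , refl ← found v (T-prefix v u t₁) (≤-reflexive (sym len))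
    with z , len′ , t₂ ← extendʳ N ((p ++ w S ++ q) ++ u) t₁
    with p′ , q′ , refl ← found z (T-suffix _ z t₂) (≤-reflexive (sym len′))
    with y , eq ← Returns.decode (returns S) (q ++ u ++ p′ ++ w S) ([] , refl)
           (T-factor p _ q′ (subst T (assoc₅ p (w S) q u p′ q′) t₂))
           (subst (Ends (w S)) (assoc₆ (w S) q u p′) (ends-++ (w S ++ q ++ u ++ p′) ([] , refl))) =
      y , subst (u isFactorOf_) eq (factor⁺ q u (p′ ++ w S))

  -- A factor no longer than w either starts after the first block or lies inside w f j.
  short-factor : ∀ (S : Stage) y p u q → length u ≤ length (w S) → w S ++ concatMap (f S) y ≡ p ++ u ++ q → T u
  short-factor S []      p u q len eq = T-factor p u q (subst T (trans (sym (++-identityʳ (w S))) eq) (w∈T S))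
  short-factor S (j ∷ y) p u q len eq with Returns.ends (returns S) j
  ... | v , e = locate (levi p v (trans (sym eq) shifted))
    where
    shifted : w S ++ f S j ++ concatMap (f S) y ≡ v ++ w S ++ concatMap (f S) y
    shifted = trans (sym (++-assoc (w S) (f S j) _)) (trans (cong (_++ concatMap (f S) y) e) (++-assoc v (w S) _))
    inside : ∀ p x z → v ≡ p ++ x → x ++ w S ≡ u ++ z → T u
    inside p x z e₁ e₂ = T-factor p u z (subst T (trans e (trans (cong (_++ w S) e₁)
      (trans (++-assoc p x (w S)) (cong (p ++_) e₂)))) (Returns.in-T (returns S) j))
    locate : (∃[ x ] (p ≡ v ++ x × w S ++ concatMap (f S) y ≡ x ++ u ++ q)) ⊎
             (∃[ x ] (v ≡ p ++ x × u ++ q ≡ x ++ w S ++ concatMap (f S) y)) → T u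
    locate (inj₁ (x , _ , e₁)) = short-factor S y x u q len e₁
    locate (inj₂ (x , e₁ , e₂)) with levi u (x ++ w S) (trans e₂ (sym (++-assoc x (w S) _)))
    ... | inj₂ (z , e₃ , _)      = inside p x z e₁ e₃
    ... | inj₁ ([] , e₃ , _)     = inside p x [] e₁ (trans (sym (++-identityʳ _)) (trans (sym e₃) (sym (++-identityʳ u))))
    ... | inj₁ (c ∷ z , e₃ , _)  = contradiction len (<⇒≱ (subst (λ u → length (w S) < length u) (sym e₃)
            (subst (length (w S) <_) (sym (trans (length-++ (x ++ w S)) (cong (_+ suc (length z)) (length-++ x))))
              (≤-<-trans (m≤n+m _ (length x)) (m<m+n _ (s≤s z≤n))))))

  T⊆Fac : ∀ {u} → T u → ∀ n → Fac (Image (compose σ 0 (suc n))) u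
  T⊆Fac {u} t n with N , S , n<N , _ , eq ← reach₀ (suc n) with y , fac ← factor-of-image S u t =
    compose σ 0 (suc n) (compose σ (suc n) (N ∸ suc n) y) , (_ , refl) ,
    subst (u isFactorOf_) (trans (eq y) (trans (cong (λ N → compose σ 0 N y) (sym (m+[n∸m]≡n n<N)))
      (compose-+ σ 0 (suc n) (N ∸ suc n) y))) fac

  Fac⊆T : ∀ {u} → (∀ n → Fac (Image (compose σ 0 (suc n))) u) → T u
  -- The successor forces at least one morphism, as the intersection starts with `σ 0`.
  Fac⊆T {u} fac with reach₀ (suc (length u))
  ... | suc N , S , _ , len , eq with fac N
  ...   | _ , (y , refl) , u⊑ with p , q , e ← factor⁻ u⊑ =
          short-factor S y (w S ++ p) u q (<⇒≤ len)
            (trans (cong (w S ++_) (trans (eq y) e)) (sym (++-assoc (w S) p (u ++ q))))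

  representation : SAdicRepresentation ElementaryPositive T σ
  representation = record
    { elements     = stream-elementary (load stage₀)
    ; intersection = (λ t n → T⊆Fac t n) , λ h → Fac⊆T h
    }

theorem5p23 : ∀ {a ℓ : Level} {A : Set a} {n : ℕ} → A ↔ Fin (suc n) →
    (T : Pred (List A) ℓ) →
    UniformlyRecurrent T → TreeSet T → (∀ (x : A) → T [ x ]) →
    ∃[ σ ] (Primitive σ × SAdicRepresentation ElementaryPositive T σ)
theorem5p23 ι T ur ts letter = σ , σ-primitive , representation
  where open TreeSetTheory ι T ur ts letter
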